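{- Let $p_n$, $d_n$ and $b_n$ denote respectively the number of 2sip-walks, deque-walks and big-walks of length $2n$ (defined in the context). Then the limits \[\mu_p=\lim_{n\to\infty}\sqrt[n]{p_n},\qquad \mu_d=\lim_{n\to\infty}\sqrt[n]{d_n},\qquad \mu_b=\lim_{n\to\infty}\sqrt[n]{b_n}\] exist, are finite, and are all equal. Equivalently, the exponential growth rate of the number of permutations of length $n$ sortable by a deque equals that of permutations of length $n$ sortable by two stacks in parallel.
   Context: All walks are finite sequences of unit steps from $\{N,E,S,W\}=\{(0,1),(1,0),(0,-1),(-1,0)\}$ on $\mathbb{Z}^2$, starting at $(0,0)$. A walk is \emph{eager} if it contains no two consecutive steps $E$ then $S$, and no two consecutive steps $N$ then $W$. A \emph{QP-subloop} of a walk is a contiguous subsequence of steps starting and ending at the same point $(p,q)$ and visiting only points $(x,y)$ with $x\ge p$, $y\ge q$. A walk is \emph{standard} if every QP-subloop (of positive length) begins with an $N$ step. A walk is \emph{vertical-happy} if every step starting from a point on the line $x+y=0$ or $x+y=1$ is $N$ or $S$. A \emph{big-walk} is a standard eager walk staying in the half-plane $\{x+y\ge 0\}$ and ending at some point $(x,-x)$. A \emph{deque-walk} is a vertical-happy big-walk. A \emph{2sip-walk} is a standard eager walk staying in the quarter-plane $\{x\ge0,y\ge0\}$ and ending at $(0,0)$. Known fact (not part of the claim to prove, but explaining the equivalent formulation): 2sip-walks of length $2n$ are in bijection with permutations of length $n$ sortable by two stacks in parallel, and deque-walks of length $2n$ are in bijection with permutations of length $n$ sortable by a double-ended queue. -}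

module Defs where

open import Data.Empty using (⊥-elim)
open import Data.Integer as ℤ using (ℤ; +_)
open import Data.Integer.Properties as ℤₚ using ()
open import Data.List using (List; []; _∷_; _++_; foldl; head; length; filter; cartesianProductWith)
open import Data.List.Relation.Unary.All as All using (All)
open import Data.List.Relation.Unary.Linked as Linked using (Linked)
open import Data.List.Scans.Base using (scanl)
open import Data.Maybe using (just)
open import Data.Maybe.Properties as Maybeₚ using ()
open import Data.Nat as ℕ using (ℕ; zero; suc; NonZero)
open import Data.Product using (∃-syntax; _×_; _,_; proj₁; proj₂)
open import Data.Product.Properties as Productₚ using ()
open import Data.Rational using (ℚ; 0ℚ; 1ℚ; _+_; _-_; -_; _*_; _<_; _≤_; _/_; _⊔_; _⊓_; 1/_; positive; nonNegative; >-nonZero; +-*-rawSemiring)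
open import Data.Rational.Properties
open import Data.Sum using (_⊎_; inj₁; inj₂)
open import Function using (_⇔_)
open import Relation.Binary using (DecidableEquality; tri<; tri≈; tri>)
open import Relation.Binary.PropositionalEquality using (_≡_; _≢_; refl; sym; trans; cong; subst)
open import Relation.Nullary using (¬_; Dec; yes; no)
open import Relation.Nullary.Decidable using (map′; _×-dec_; _⊎-dec_; _→-dec_; ¬?)
open import Relation.Unary using (Decidable)

open import Algebra.Definitions.RawSemiring +-*-rawSemiring using (_^_)

data Step : Set where
  N E S W : Step

Walk : Set
Walk = List Step

Point : Set
Point = ℤ × ℤ

origin : Point
origin = + 0 , + 0

step : Point → Step → Point
step (x , y) N = x , y ℤ.+ + 1
step (x , y) E = x ℤ.+ + 1 , y
step (x , y) S = x , y ℤ.- + 1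
step (x , y) W = x ℤ.- + 1 , y

end : Point → Walk → Point
end = foldl step

visited : Point → Walk → List Point
visited = scanl step

Eager : Walk → Set
Eager = Linked (λ s t → ¬ (s ≡ E × t ≡ S) × ¬ (s ≡ N × t ≡ W))

IsQPLoopAt : Point → Walk → Set
IsQPLoopAt p v =
  end p v ≡ p ×
  All (λ r → proj₁ p ℤ.≤ proj₁ r × proj₂ p ℤ.≤ proj₂ r) (visited p v)

Standard : Walk → Set
Standard w =
  ∀ u v t → u ++ v ++ t ≡ w → v ≢ [] → IsQPLoopAt (end origin u) v → head v ≡ just N

coordSum : Point → ℤ
coordSum (x , y) = x ℤ.+ y

VerticalHappy : Walk → Set
VerticalHappy w =
  ∀ u s t → u ++ s ∷ t ≡ w →
  coordSum (end origin u) ≡ + 0 ⊎ coordSum (end origin u) ≡ + 1 →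
  s ≡ N ⊎ s ≡ S

InHalfPlane : Walk → Set
InHalfPlane w = All (λ p → + 0 ℤ.≤ coordSum p) (visited origin w)

InQuarterPlane : Walk → Set
InQuarterPlane w = All (λ p → + 0 ℤ.≤ proj₁ p × + 0 ℤ.≤ proj₂ p) (visited origin w)

BigWalk : Walk → Set
BigWalk w =
  Standard w × Eager w × InHalfPlane w × ∃[ x ] end origin w ≡ (x , ℤ.- x)

DequeWalk : Walk → Set
DequeWalk w = VerticalHappy w × BigWalk w

TwoSipWalk : Walk → Set
TwoSipWalk w =
  Standard w × Eager w × InQuarterPlane w × end origin w ≡ origin

infix 4 _≟ˢ_ _≟ᵖ_

_≟ˢ_ : DecidableEquality Step
N ≟ˢ N = yes refl
N ≟ˢ E = no λ ()
N ≟ˢ S = no λ ()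
N ≟ˢ W = no λ ()
E ≟ˢ N = no λ ()
E ≟ˢ E = yes refl
E ≟ˢ S = no λ ()
E ≟ˢ W = no λ ()
S ≟ˢ N = no λ ()
S ≟ˢ E = no λ ()
S ≟ˢ S = yes refl
S ≟ˢ W = no λ ()
W ≟ˢ N = no λ ()
W ≟ˢ E = no λ ()
W ≟ˢ S = no λ ()
W ≟ˢ W = yes refl

_≟ᵖ_ : DecidableEquality Point
_≟ᵖ_ = Productₚ.≡-dec ℤₚ._≟_ ℤₚ._≟_

∀splits? : {Q : Walk → Walk → Set} → (∀ u t → Dec (Q u t)) →
           ∀ w → Dec (∀ u t → u ++ t ≡ w → Q u t)
∀splits? Q? [] = map′ (λ { q [] [] refl → q }) (λ f → f [] [] refl) (Q? [] [])
∀splits? Q? (s ∷ w) = map′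
  (λ { (q , f) [] t refl → q ; (q , f) (x ∷ u) t refl → f u t refl })
  (λ f → f [] (s ∷ w) refl , λ { u t refl → f (s ∷ u) t refl })
  (Q? [] (s ∷ w) ×-dec ∀splits? (λ u t → Q? (s ∷ u) t) w)

nonempty? : (v : Walk) → Dec (v ≢ [])
nonempty? []      = no λ f → f refl
nonempty? (_ ∷ _) = yes λ ()

eager? : Decidable Eager
eager? = Linked.linked? λ s t →
  ¬? ((s ≟ˢ E) ×-dec (t ≟ˢ S)) ×-dec ¬? ((s ≟ˢ N) ×-dec (t ≟ˢ W))

isQPLoopAt? : ∀ p v → Dec (IsQPLoopAt p v)
isQPLoopAt? p v = (end p v ≟ᵖ p) ×-dec
  All.all? (λ r → (proj₁ p ℤₚ.≤? proj₁ r) ×-dec (proj₂ p ℤₚ.≤? proj₂ r)) (visited p v)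

standard? : Decidable Standard
standard? w = map′
  (λ f u v t eq → f u (v ++ t) eq v t refl)
  (λ { f u r eq v t refl → f u v t eq })
  (∀splits? (λ u r → ∀splits? (λ v t →
     nonempty? v →-dec isQPLoopAt? (end origin u) v →-dec
     Maybeₚ.≡-dec _≟ˢ_ (head v) (just N)) r) w)

verticalHappy? : Decidable VerticalHappy
verticalHappy? w = map′
  (λ f u s t eq → f u (s ∷ t) eq s t refl)
  (λ { f u r eq s t refl → f u s t eq })
  (∀splits? onSplit? w)
  where
  onSplit? : ∀ u r → Dec (∀ s t → r ≡ s ∷ t →
    coordSum (end origin u) ≡ + 0 ⊎ coordSum (end origin u) ≡ + 1 → s ≡ N ⊎ s ≡ S)
  onSplit? u []      = yes λ _ _ ()
  onSplit? u (s ∷ t) = map′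
    (λ { f _ _ refl → f }) (λ f → f s t refl)
    (((coordSum (end origin u) ℤₚ.≟ + 0) ⊎-dec (coordSum (end origin u) ℤₚ.≟ + 1))
      →-dec ((s ≟ˢ N) ⊎-dec (s ≟ˢ S)))

bigWalk? : Decidable BigWalk
bigWalk? w = standard? w ×-dec eager? w
  ×-dec All.all? (λ p → + 0 ℤₚ.≤? coordSum p) (visited origin w)
  ×-dec map′ (λ eq → _ , eq) (λ { (x , eq) → trans eq (cong (λ p → proj₁ p , ℤ.- proj₁ p) (sym eq)) })
          (end origin w ≟ᵖ (proj₁ (end origin w) , ℤ.- proj₁ (end origin w)))

dequeWalk? : Decidable DequeWalk
dequeWalk? w = verticalHappy? w ×-dec bigWalk? w

twoSipWalk? : Decidable TwoSipWalk
twoSipWalk? w = standard? w ×-dec eager? w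
  ×-dec All.all? (λ p → (+ 0 ℤₚ.≤? proj₁ p) ×-dec (+ 0 ℤₚ.≤? proj₂ p)) (visited origin w)
  ×-dec (end origin w ≟ᵖ origin)

-- Every walk of the given length, listed exactly once.
walks : ℕ → List Walk
walks zero    = [] ∷ []
walks (suc m) = cartesianProductWith _∷_ (N ∷ E ∷ S ∷ W ∷ []) (walks m)

p d b : ℕ → ℕ
p n = length (filter twoSipWalk? (walks (2 ℕ.* n)))
d n = length (filter dequeWalk? (walks (2 ℕ.* n)))
b n = length (filter bigWalk? (walks (2 ℕ.* n)))

-- Real numbers as two-sided Dedekind cuts: `lower q` says q < x and
-- `upper q` says x < q.  Cuts are inhabited on both sides, so every real
-- is finite.  Because cuts are located, the supremum of a bounded sequence of
-- reals is a real only with excluded middle, as in classical analysis.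
record ℝ : Set₁ where
  field
    lower upper     : ℚ → Set
    lower-inhabited : ∃[ q ] lower q
    upper-inhabited : ∃[ q ] upper q
    lower-closed    : ∀ {q r} → q < r → lower r → lower q
    upper-closed    : ∀ {q r} → q < r → upper q → upper r
    lower-open      : ∀ {q} → lower q → ∃[ r ] q < r × lower r
    upper-open      : ∀ {q} → upper q → ∃[ r ] r < q × upper r
    disjoint        : ∀ {q} → ¬ (lower q × upper q)
    located         : ∀ {q r} → q < r → lower q ⊎ upper r

open ℝ public

infix 4 _≈ᴿ_ _<ᴿ_ _⟶_

_≈ᴿ_ : ℝ → ℝ → Set
x ≈ᴿ y = ∀ q → (lower x q ⇔ lower y q) × (upper x q ⇔ upper y q)

_<ᴿ_ : ℝ → ℝ → Set
x <ᴿ y = ∃[ q ] upper x q × lower y q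

private
  shift-< : ∀ {q r} ε → q < r → q - ε < r - ε
  shift-< ε = +-monoˡ-< (- ε)

  +-sub : ∀ q ε → (q + ε) - ε ≡ q
  +-sub q ε = trans (+-assoc q ε (- ε)) (trans (cong (λ z → q + z) (+-inverseʳ ε)) (+-identityʳ q))

  sub-+ : ∀ q ε → (q - ε) + ε ≡ q
  sub-+ q ε = trans (+-assoc q (- ε) ε) (trans (cong (λ z → q + z) (+-inverseˡ ε)) (+-identityʳ q))

infixl 6 _+ᴿ_

_+ᴿ_ : ℝ → ℚ → ℝ
x +ᴿ ε = record
  { lower           = λ q → lower x (q - ε)
  ; upper           = λ q → upper x (q - ε)
  ; lower-inhabited = let q , l = lower-inhabited x in q + ε , subst (lower x) (sym (+-sub q ε)) l
  ; upper-inhabited = let q , u = upper-inhabited x in q + ε , subst (upper x) (sym (+-sub q ε)) u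
  ; lower-closed    = λ q<r → lower-closed x (shift-< ε q<r)
  ; upper-closed    = λ q<r → upper-closed x (shift-< ε q<r)
  ; lower-open      = λ {q} l → let r , q<r , l′ = lower-open x l in
      r + ε , subst (_< r + ε) (sub-+ q ε) (+-monoˡ-< ε q<r) , subst (lower x) (sym (+-sub r ε)) l′
  ; upper-open      = λ {q} u → let r , r<q , u′ = upper-open x u in
      r + ε , subst (r + ε <_) (sub-+ q ε) (+-monoˡ-< ε r<q) , subst (upper x) (sym (+-sub r ε)) u′
  ; disjoint        = disjoint x
  ; located         = λ q<r → located x (shift-< ε q<r)
  }

-- The two strict inequalities together say |xₙ - μ| < ε.
_⟶_ : (ℕ → ℝ) → ℝ → Set
x ⟶ μ = ∀ ε → 0ℚ < ε →
  ∃[ m ] (∀ n → m ℕ.≤ n → x n <ᴿ μ +ᴿ ε × μ <ᴿ x n +ᴿ ε)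

fromℕ : ℕ → ℚ
fromℕ a = + a / 1

private
  fromℕ≥0 : ∀ a → 0ℚ ≤ fromℕ a
  fromℕ≥0 a = nonNegative⁻¹ (fromℕ a) {{normalize-nonNeg a 1}}

  *-monoʳ : ∀ {x y} z → 0ℚ ≤ z → x ≤ y → x * z ≤ y * z
  *-monoʳ z 0≤z = *-monoʳ-≤-nonNeg z {{nonNegative 0≤z}}

  *-monoˡ : ∀ {x y} z → 0ℚ ≤ z → x ≤ y → z * x ≤ z * y
  *-monoˡ z 0≤z = *-monoˡ-≤-nonNeg z {{nonNegative 0≤z}}

  *-mono : ∀ {x y u v} → 0ℚ ≤ x → 0ℚ ≤ v → x ≤ y → u ≤ v → x * u ≤ y * v
  *-mono 0≤x 0≤v x≤y u≤v = ≤-trans (*-monoˡ _ 0≤x u≤v) (*-monoʳ _ 0≤v x≤y)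

  ^-nonNeg : ∀ {x} n → 0ℚ ≤ x → 0ℚ ≤ x ^ n
  ^-nonNeg zero    0≤x = <⇒≤ (positive⁻¹ 1ℚ)
  ^-nonNeg {x} (suc n) 0≤x = subst (_≤ x * x ^ n) (*-zeroʳ x) (*-monoˡ x 0≤x (^-nonNeg n 0≤x))

  ^-pos : ∀ {x} n → 0ℚ < x → 0ℚ < x ^ n
  ^-pos zero    0<x = positive⁻¹ 1ℚ
  ^-pos {x} (suc n) 0<x =
    subst (_< x * x ^ n) (*-zeroʳ x) (*-monoʳ-<-pos x {{positive 0<x}} (^-pos n 0<x))

  ^-mono : ∀ {x y} n → 0ℚ ≤ x → x ≤ y → x ^ n ≤ y ^ n
  ^-mono zero    0≤x x≤y = ≤-refl
  ^-mono (suc n) 0≤x x≤y = *-mono 0≤x (^-nonNeg n (≤-trans 0≤x x≤y)) x≤y (^-mono n 0≤x x≤y)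

  ^-mono-< : ∀ {x y} n .{{_ : NonZero n}} → 0ℚ ≤ x → x < y → x ^ n < y ^ n
  ^-mono-< {x} {y} (suc n) 0≤x x<y = ≤-<-trans
    (*-monoˡ x 0≤x (^-mono n 0≤x (<⇒≤ x<y)))
    (*-monoˡ-<-pos (y ^ n) {{positive (^-pos n (≤-<-trans 0≤x x<y))}} x<y)

  1≤^ : ∀ {x} n → 1ℚ ≤ x → 1ℚ ≤ x ^ n
  1≤^ zero    1≤x = ≤-refl
  1≤^ {x} (suc n) 1≤x = *-mono {1ℚ} {x} {1ℚ} {x ^ n}
    0≤1 (≤-trans 0≤1 (1≤^ n 1≤x)) 1≤x (1≤^ n 1≤x)
    where 0≤1 = <⇒≤ (positive⁻¹ 1ℚ)

  x≤x^n : ∀ {x} n .{{_ : NonZero n}} → 1ℚ ≤ x → x ≤ x ^ n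
  x≤x^n {x} (suc n) 1≤x = subst (_≤ x * x ^ n) (*-identityʳ x)
    (*-monoˡ x (≤-trans (<⇒≤ (positive⁻¹ 1ℚ)) 1≤x) (1≤^ n 1≤x))

  quotient : ∀ {y} → 0ℚ < y → ∀ c → ∃[ x ] x * y ≡ c
  quotient {y} 0<y c = c * (1/ y) {{nz}} ,
    trans (*-assoc c _ y) (trans (cong (c *_) (*-inverseˡ y {{nz}})) (*-identityʳ c))
    where nz = >-nonZero 0<y

  *-cancelʳ : ∀ {x y z} → 0ℚ ≤ z → x * z < y * z → x < y
  *-cancelʳ {z = z} 0≤z = *-cancelʳ-<-nonNeg z {{nonNegative 0≤z}}

  pos-factor : ∀ {x y} → 0ℚ < y → 0ℚ < x * y → 0ℚ < x
  pos-factor {x} {y} 0<y 0<xy = *-cancelʳ (<⇒≤ 0<y) (subst (_< x * y) (sym (*-zeroˡ y)) 0<xy)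

  x<x+1 : ∀ x → x < x + 1ℚ
  x<x+1 x = subst (_< x + 1ℚ) (+-identityʳ x) (+-monoʳ-< x (positive⁻¹ 1ℚ))

  raiseʳ : ∀ {x y c} → 0ℚ ≤ y → x * y < c → ∃[ x′ ] x < x′ × x′ * y < c
  raiseʳ {x} {y} {c} 0≤y xy<c with <-cmp 0ℚ y
  ... | tri> _ _ y<0 = ⊥-elim (<-irrefl refl (≤-<-trans 0≤y y<0))
  ... | tri≈ _ refl _ = x + 1ℚ , x<x+1 x ,
    subst (_< c) (trans (*-zeroʳ x) (sym (*-zeroʳ (x + 1ℚ)))) xy<c
  ... | tri< 0<y _ _ with <-dense xy<c
  ...   | e , xy<e , e<c with quotient 0<y e
  ...     | x′ , refl = x′ , *-cancelʳ 0≤y xy<e , e<c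

  lowerʳ : ∀ {x y c} → 0ℚ < y → 0ℚ ≤ c → c < x * y → ∃[ x′ ] 0ℚ < x′ × x′ < x × c < x′ * y
  lowerʳ 0<y 0≤c c<xy with <-dense c<xy
  ... | e , c<e , e<xy with quotient 0<y e
  ...   | x′ , refl = x′ , pos-factor 0<y (≤-<-trans 0≤c c<e) , *-cancelʳ (<⇒≤ 0<y) e<xy , c<e

  ^-raise : ∀ {q c} n → 0ℚ ≤ q → q ^ n < c → ∃[ r ] q < r × r ^ n < c
  ^-raise {q} zero 0≤q lt = q + 1ℚ , x<x+1 q , lt
  ^-raise {q} {c} (suc n) 0≤q lt with raiseʳ (^-nonNeg n 0≤q) lt
  ... | x , q<x , lt₁ with raiseʳ (≤-trans 0≤q (<⇒≤ q<x)) (subst (_< c) (*-comm x (q ^ n)) lt₁)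
  ...   | y , qⁿ<y , lt₂ with ^-raise n 0≤q qⁿ<y
  ...     | s , q<s , sⁿ<y = x ⊓ s , q<r , ≤-<-trans
    (*-mono 0≤r (≤-trans (^-nonNeg n 0≤q) (<⇒≤ qⁿ<y)) (p⊓q≤p x s)
      (≤-trans (^-mono n 0≤r (p⊓q≤q x s)) (<⇒≤ sⁿ<y)))
    (subst (_< c) (*-comm y x) lt₂)
    where
    q<r : q < x ⊓ s
    q<r with ⊓-sel x s
    ... | inj₁ eq = subst (q <_) (sym eq) q<x
    ... | inj₂ eq = subst (q <_) (sym eq) q<s
    0≤r = ≤-trans 0≤q (<⇒≤ q<r)

  ^-lower : ∀ {q c} n → 0ℚ < q → 0ℚ ≤ c → c < q ^ n → ∃[ r ] 0ℚ < r × r < q × c < r ^ n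
  ^-lower zero 0<q 0≤c lt with <-dense 0<q
  ... | r , 0<r , r<q = r , 0<r , r<q , lt
  ^-lower {q} {c} (suc n) 0<q 0≤c lt with lowerʳ (^-pos n 0<q) 0≤c lt
  ... | x , 0<x , x<q , lt₁ with lowerʳ 0<x 0≤c (subst (c <_) (*-comm x (q ^ n)) lt₁)
  ...   | y , 0<y , y<qⁿ , lt₂ with ^-lower n 0<q (<⇒≤ 0<y) y<qⁿ
  ...     | s , 0<s , s<q , y<sⁿ = x ⊔ s , 0<r , r<q , <-≤-trans
    (subst (c <_) (*-comm y x) lt₂)
    (*-mono (<⇒≤ 0<x) (^-nonNeg n (<⇒≤ 0<r)) (p≤p⊔q x s)
      (≤-trans (<⇒≤ y<sⁿ) (^-mono n (<⇒≤ 0<s) (p≤q⊔p x s))))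
    where
    0<r = <-≤-trans 0<x (p≤p⊔q x s)
    r<q : x ⊔ s < q
    r<q with ⊔-sel x s
    ... | inj₁ eq = subst (_< q) (sym eq) x<q
    ... | inj₂ eq = subst (_< q) (sym eq) s<q

-- The disjunct q < 0 in the lower cut is needed because q ^ n may be large for
-- negative q when n is even.
module _ (n : ℕ) .{{_ : NonZero n}} (a : ℕ) where

  private
    A = fromℕ a

    Lower Upper : ℚ → Set
    Lower q = q < 0ℚ ⊎ q ^ n < A
    Upper q = 0ℚ < q × A < q ^ n

    lower-closed′ : ∀ {q r} → q < r → Lower r → Lower q
    lower-closed′ q<r (inj₁ r<0) = inj₁ (<-trans q<r r<0)
    lower-closed′ {q} q<r (inj₂ lt) with q <? 0ℚ
    ... | yes q<0 = inj₁ q<0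
    ... | no  q≮0 = inj₂ (≤-<-trans (^-mono n (≮⇒≥ q≮0) (<⇒≤ q<r)) lt)

    lower-open′ : ∀ {q} → Lower q → ∃[ r ] q < r × Lower r
    lower-open′ {q} l with q <? 0ℚ
    lower-open′ l | yes q<0 with <-dense q<0
    ... | r , q<r , r<0 = r , q<r , inj₁ r<0
    lower-open′ (inj₁ q<0) | no q≮0 = ⊥-elim (q≮0 q<0)
    lower-open′ (inj₂ lt)  | no q≮0 with ^-raise n (≮⇒≥ q≮0) lt
    ... | r , q<r , lt′ = r , q<r , inj₂ lt′

    located′ : ∀ {q r} → q < r → Lower q ⊎ Upper r
    located′ {q} q<r with q <? 0ℚ | q ^ n <? A
    ... | yes q<0 | _      = inj₁ (inj₁ q<0)
    ... | no _    | yes lt = inj₁ (inj₂ lt)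
    ... | no q≮0  | no ge  = inj₂
      (≤-<-trans (≮⇒≥ q≮0) q<r , ≤-<-trans (≮⇒≥ ge) (^-mono-< n (≮⇒≥ q≮0) q<r))

    1≤A+1 : 1ℚ ≤ A + 1ℚ
    1≤A+1 = subst (_≤ A + 1ℚ) (+-identityˡ 1ℚ) (+-monoˡ-≤ 1ℚ (fromℕ≥0 a))

  root : ℝ
  root = record
    { lower           = λ q → q < 0ℚ ⊎ q ^ n < fromℕ a
    ; upper           = λ q → 0ℚ < q × fromℕ a < q ^ n
    ; lower-inhabited = - 1ℚ , inj₁ (negative⁻¹ (- 1ℚ))
    ; upper-inhabited = A + 1ℚ , <-≤-trans (positive⁻¹ 1ℚ) 1≤A+1 ,
                        <-≤-trans (x<x+1 A) (x≤x^n n 1≤A+1)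
    ; lower-closed    = lower-closed′
    ; upper-closed    = λ { q<r (0<q , lt) →
        <-trans 0<q q<r , <-≤-trans lt (^-mono n (<⇒≤ 0<q) (<⇒≤ q<r)) }
    ; lower-open      = lower-open′
    ; upper-open      = λ { (0<q , lt) →
        let r , 0<r , r<q , lt′ = ^-lower n 0<q (fromℕ≥0 a) lt in r , r<q , 0<r , lt′ }
    ; disjoint        = λ { (inj₁ q<0 , 0<q , _) → <-asym q<0 0<q
                          ; (inj₂ lt , _ , lt′)  → <-asym lt lt′ }
    ; located         = located′
    }

-- Indexing starts at n = 1, where the n-th root is meaningful.
nthRoots : (ℕ → ℕ) → ℕ → ℝ
nthRoots a k = root (suc k) (a (suc k))

{-# OPTIONS --safe #-}
module Submission where

open import Defs
open import Algebra.Bundles using (AbelianGroup)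
import Algebra.Properties.Group as GroupProperties
open import Axiom.ExcludedMiddle using (ExcludedMiddle)
open import Data.Empty using (⊥-elim)
open import Data.Integer as ℤ using (+_; -[1+_])
import Data.Integer.Properties as ℤₚ
import Data.Integer.Tactic.RingSolver as ℤSolver
open import Data.List using (List; []; _∷_; _++_; [_]; head; last; length; map; filter; cartesianProduct; cartesianProductWith)
open import Data.List.Properties using (++-assoc; ++-identityʳ; ++-cancelˡ; ++-cancelʳ; ∷-injective; foldl-++; length-++; length-map; length-filter; filter-all; map-injective; map-∘; map-cong; map-id)
open import Data.List.Membership.Propositional using (_∈_)
open import Data.List.Membership.Propositional.Properties using (∈-∃++; ∈-++⁺ˡ; ∈-++⁺ʳ; ∈-++⁻; ∈-filter⁺; ∈-filter⁻; ∈-cartesianProductWith⁺; ∈-cartesianProductWith⁻; ∈-cartesianProduct⁻)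
open import Data.List.Relation.Binary.Sublist.Propositional.Properties using (filter-⊆; filter⁺; length-mono-≤)
open import Data.List.Relation.Unary.All as All using (All; []; _∷_)
import Data.List.Relation.Unary.All.Properties as Allₚ
open import Data.List.Relation.Unary.Any using (here; there)
open import Data.List.Relation.Unary.Linked as Linked using ([]; [-]; _∷_)
open import Data.List.Relation.Unary.Unique.Propositional using (Unique; []; _∷_)
import Data.List.Relation.Unary.Unique.Propositional.Properties as Uniqueₚ
open import Data.Maybe using (just)
open import Data.Nat as ℕ using (ℕ; zero; suc; z≤n; s≤s; _≤_; _<_; _+_; _*_; _^_; NonZero; >-nonZero)
import Data.Nat.Coprimality as Coprime
open import Data.Nat.DivMod using (_/_; _%_; m≡m%n+[m/n]*n; m%n≤n; /-monoˡ-≤; m*n/n≡m)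
import Data.Nat.Properties as ℕₚ
import Data.Nat.Tactic.RingSolver as ℕSolver
open import Data.Product using (∃-syntax; _×_; _,_; proj₁; proj₂; map₁)
open import Data.Rational as ℚ using (ℚ; mkℚ; 0ℚ; 1ℚ; ½; ↥_; ↧_; toℚᵘ)
import Data.Rational.Properties as ℚₚ
import Data.Rational.Unnormalised as ℚᵘ
import Data.Rational.Unnormalised.Properties as ℚᵘₚ
open import Data.Sum using (_⊎_; inj₁; inj₂)
open import Function using (_∘_; id; mk⇔)
open import Level using (0ℓ)
open import Relation.Binary.PropositionalEquality hiding ([_])
open import Relation.Nullary using (¬_; contradiction; yes; no)
open import Relation.Nullary.Decidable using (¬?)
open import Relation.Unary using (Decidable)

open import Algebra.Definitions.RawSemiring ℚ.+-*-rawSemiring using () renaming (_^_ to _^ℚ_)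

-- Supermultiplicativity (concatenate walks) and b n ≤ 16 ^ n make the three growth
-- rates exist, by Fekete's lemma, and p, d ≤ b.  Prefixing NN and appending SS turns
-- a big-walk into a deque-walk, so d grows as fast as b.  For p, pair big-walks with
-- a common end point (x , − x): mirroring in the diagonal the steps of the second one
-- that lie in no QP-subloop is injective, keeps it a big-walk and negates x, so the
-- concatenation closes up.  This loses only a polynomial factor.  Closed big-walks of
-- a fixed length can be concatenated without ever leaving a fixed translate of the
-- quarter-plane, and a prefix and suffix of bounded length turn the result into a
-- 2sip-walk.

-- Reflection in the diagonal swaps the forbidden pairs `E S` and `N W`, so eagerness is symmetric
-- under it, but a reflected subloop would begin with `E`. Hence subloops are left alone. This is
-- possible because every walk is, in exactly one way, an initial loop followed by steps that each
-- carry a loop, where the steps by themselves contain no subloop: all subloops of the walk then lie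
-- inside those loops. Uniqueness of this form is what makes the mirroring injective. Lifting a
-- closed big-walk above the axes costs steps in proportion to its depth, so the depth has to be
-- fixed before the number of concatenated blocks grows. Growth rates are compared in the natural
-- numbers: for `q = u / w` nonnegative, `q` lies below the n-th root of `a n` exactly when
-- `u ^ n < a n * w ^ n`. Each comparison lowers `u` a little; fractions are expanded by 5 to pay
-- for all of them. The common limit is the supremum of the roots of `b`.

infixl 6 _⊕_
infix 4 _⊑_

_⊕_ : Point → Point → Point
(x , y) ⊕ (x′ , y′) = x ℤ.+ x′ , y ℤ.+ y′

neg : Point → Point
neg (x , y) = ℤ.- x , ℤ.- y

_⊑_ : Point → Point → Set
p ⊑ r = proj₁ p ℤ.≤ proj₁ r × proj₂ p ℤ.≤ proj₂ r

⊕-identityʳ : ∀ p → p ⊕ origin ≡ p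
⊕-identityʳ p = cong₂ _,_ (ℤₚ.+-identityʳ _) (ℤₚ.+-identityʳ _)

⊕-inverseˡ : ∀ p → neg p ⊕ p ≡ origin
⊕-inverseˡ (x , y) = cong₂ _,_ (ℤₚ.+-inverseˡ x) (ℤₚ.+-inverseˡ y)

⊕-mono-⊑ : ∀ c {p q} → p ⊑ q → c ⊕ p ⊑ c ⊕ q
⊕-mono-⊑ (x , y) (l , m) = ℤₚ.+-monoʳ-≤ x l , ℤₚ.+-monoʳ-≤ y m

⊑-refl : ∀ {p} → p ⊑ p
⊑-refl = ℤₚ.≤-refl , ℤₚ.≤-refl

⊑-trans : ∀ {p q r} → p ⊑ q → q ⊑ r → p ⊑ r
⊑-trans (a , b) (c , d) = ℤₚ.≤-trans a c , ℤₚ.≤-trans b d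

⊑-antisym : ∀ {p q} → p ⊑ q → q ⊑ p → p ≡ q
⊑-antisym (a , b) (c , d) = cong₂ _,_ (ℤₚ.≤-antisym a c) (ℤₚ.≤-antisym b d)

coordSum-⊕ : ∀ p q → coordSum (p ⊕ q) ≡ coordSum p ℤ.+ coordSum q
coordSum-⊕ (x , y) (x′ , y′) = lemma x y x′ y′
  where
  lemma : ∀ x y x′ y′ → (x ℤ.+ x′) ℤ.+ (y ℤ.+ y′) ≡ (x ℤ.+ y) ℤ.+ (x′ ℤ.+ y′)
  lemma = ℤSolver.solve-∀

coordSum-mono : ∀ {p q} → p ⊑ q → coordSum p ℤ.≤ coordSum q
coordSum-mono (a , b) = ℤₚ.+-mono-≤ a b

⊑∧coordSum≤⇒≡ : ∀ {p q} → p ⊑ q → coordSum q ℤ.≤ coordSum p → q ≡ p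
⊑∧coordSum≤⇒≡ {p} {q} (a , b) le = cong₂ _,_ (ℤₚ.≤-antisym a′ a) (ℤₚ.≤-antisym b′ b)
  where
  a′ : proj₁ q ℤ.≤ proj₁ p
  a′ = ℤₚ.≮⇒≥ λ lt → ℤₚ.<⇒≱ (ℤₚ.+-mono-<-≤ lt b) le
  b′ : proj₂ q ℤ.≤ proj₂ p
  b′ = ℤₚ.≮⇒≥ λ lt → ℤₚ.<⇒≱ (ℤₚ.+-mono-≤-< a lt) le

module _ where
  private
    shift+ : ∀ c x → c ℤ.+ x ℤ.+ + 1 ≡ c ℤ.+ (x ℤ.+ + 1)
    shift+ = ℤSolver.solve-∀
    shift- : ∀ c x → c ℤ.+ x ℤ.- + 1 ≡ c ℤ.+ (x ℤ.- + 1)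
    shift- = ℤSolver.solve-∀

  step-⊕ : ∀ c p s → step (c ⊕ p) s ≡ c ⊕ step p s
  step-⊕ (a , b) (x , y) N = cong (a ℤ.+ x ,_) (shift+ b y)
  step-⊕ (a , b) (x , y) E = cong (_, b ℤ.+ y) (shift+ a x)
  step-⊕ (a , b) (x , y) S = cong (a ℤ.+ x ,_) (shift- b y)
  step-⊕ (a , b) (x , y) W = cong (_, b ℤ.+ y) (shift- a x)

end-⊕ : ∀ c p w → end (c ⊕ p) w ≡ c ⊕ end p w
end-⊕ c p []      = refl
end-⊕ c p (s ∷ w) = trans (cong (λ q → end q w) (step-⊕ c p s)) (end-⊕ c (step p s) w)

end-from : ∀ p w → end p w ≡ p ⊕ end origin w
end-from p w = trans (cong (λ q → end q w) (sym (⊕-identityʳ p))) (end-⊕ p origin w)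

end-++ : ∀ p u v → end p (u ++ v) ≡ end (end p u) v
end-++ p u v = foldl-++ step p u v

end-++-⊕ : ∀ u v → end origin (u ++ v) ≡ end origin u ⊕ end origin v
end-++-⊕ u v = trans (end-++ origin u v) (end-from _ v)

visited-⊕ : ∀ c p w → visited (c ⊕ p) w ≡ map (c ⊕_) (visited p w)
visited-⊕ c p []      = refl
visited-⊕ c p (s ∷ w) =
  cong (c ⊕ p ∷_) (trans (cong (λ q → visited q w) (step-⊕ c p s)) (visited-⊕ c (step p s) w))

All-visited-⊕ : ∀ {P : Point → Set} c p w → All (P ∘ (c ⊕_)) (visited p w) → All P (visited (c ⊕ p) w)
All-visited-⊕ c p w h = subst (All _) (sym (visited-⊕ c p w)) (Allₚ.map⁺ h)

All-visited-from : ∀ {P : Point → Set} p w → All (P ∘ (p ⊕_)) (visited origin w) → All P (visited p w)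
All-visited-from {P} p w h =
  subst (λ q → All P (visited q w)) (⊕-identityʳ p) (All-visited-⊕ {P} p origin w h)

All-visited-++ : ∀ {P : Point → Set} a u {v} →
  All P (visited a u) → All P (visited (end a u) v) → All P (visited a (u ++ v))
All-visited-++ a []      _        h = h
All-visited-++ a (s ∷ u) (q ∷ qs) h = q ∷ All-visited-++ (step a s) u qs h

All-visited-++⁻ : ∀ {P : Point → Set} a u {v} →
  All P (visited a (u ++ v)) → All P (visited a u) × All P (visited (end a u) v)
All-visited-++⁻ a []      h        = All.head h ∷ [] , h
All-visited-++⁻ a (s ∷ u) (q ∷ qs) =
  let h₁ , h₂ = All-visited-++⁻ (step a s) u qs in q ∷ h₁ , h₂

visited-start : ∀ {P : Point → Set} a w → All P (visited a w) → P a
visited-start a w = All.head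

visited-end : ∀ {P : Point → Set} a w → All P (visited a w) → P (end a w)
visited-end a w h = visited-start _ []
  (proj₂ (All-visited-++⁻ a w (subst (All _ ∘ visited a) (sym (++-identityʳ w)) h)))

-- Subloops, excursions and standardness

Loop : Walk → Set
Loop = IsQPLoopAt origin

loop-⊕ : ∀ c p v → IsQPLoopAt p v → IsQPLoopAt (c ⊕ p) v
loop-⊕ c p v (e , h) =
  trans (end-⊕ c p v) (cong (c ⊕_) e) , All-visited-⊕ c p v (All.map (⊕-mono-⊑ c) h)

loop-at : ∀ p {v} → Loop v → IsQPLoopAt p v
loop-at p {v} h = subst (λ q → IsQPLoopAt q v) (⊕-identityʳ p) (loop-⊕ p origin v h)

loop-from : ∀ p {v} → IsQPLoopAt p v → Loop v
loop-from p {v} h = subst (λ q → IsQPLoopAt q v) (⊕-inverseˡ p) (loop-⊕ (neg p) p v h)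

Loop-[] : Loop []
Loop-[] = refl , ⊑-refl ∷ []

loop-split : ∀ u {v} → Loop (u ++ v) → end origin u ≡ origin → Loop u × Loop v
loop-split u {v} (e , h) eq =
  let h₁ , h₂ = All-visited-++⁻ origin u h in
  (eq , h₁) ,
  ( trans (cong (λ q → end q v) (sym eq)) (trans (sym (end-++ origin u v)) e)
  , subst (λ q → All (origin ⊑_) (visited q v)) eq h₂ )

-- Subloops do not depend on where the walk starts, so the base point can be dropped.
Std : Walk → Set
Std w = ∀ u v t → u ++ v ++ t ≡ w → v ≢ [] → Loop v → head v ≡ just N

Std⇒Standard : ∀ {w} → Std w → Standard w
Std⇒Standard h u v t eq ne l = h u v t eq ne (loop-from (end origin u) l)

Standard⇒Std : ∀ {w} → Standard w → Std w
Standard⇒Std h u v t eq ne l = h u v t eq ne (loop-at (end origin u) l)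

-- Relative position of the cuts in two factorisations of one word. Coinciding cuts fit both
-- constructors; `cut-++` answers `left` for them.
data Cut {A : Set} (u t w₁ w₂ : List A) : Set where
  left  : ∀ r → u ++ r ≡ w₁ → r ++ w₂ ≡ t → Cut u t w₁ w₂
  right : ∀ r → w₁ ++ r ≡ u → r ++ t ≡ w₂ → Cut u t w₁ w₂

cut-++ : {A : Set} (u t w₁ w₂ : List A) → u ++ t ≡ w₁ ++ w₂ → Cut u t w₁ w₂
cut-++ []      t w₁       w₂ eq = left w₁ refl (sym eq)
cut-++ (x ∷ u) t []       w₂ eq = right (x ∷ u) refl eq
cut-++ (x ∷ u) t (y ∷ w₁) w₂ eq with ∷-injective eq
... | refl , eq′ with cut-++ u t w₁ w₂ eq′
...   | left r refl e = left r refl e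
...   | right r refl e = right r refl e

-- In terms of the height `x + y` this is a Dyck path.
Excursion : Walk → Set
Excursion w = InHalfPlane w × coordSum (end origin w) ≡ + 0

Loop⇒Excursion : ∀ {v} → Loop v → Excursion v
Loop⇒Excursion (e , h) = All.map coordSum-mono h , cong coordSum e

excursion-++ : ∀ {w₁ w₂} → Excursion w₁ → Excursion w₂ → Excursion (w₁ ++ w₂)
excursion-++ {w₁} {w₂} (h₁ , e₁) (h₂ , e₂) =
  All-visited-++ origin w₁ h₁ (All-visited-from _ w₂ (All.map shift h₂)) ,
  trans (cong coordSum (end-++-⊕ w₁ w₂)) (trans (coordSum-⊕ (end origin w₁) (end origin w₂)) (cong₂ ℤ._+_ e₁ e₂))
  where
  shift : ∀ {p} → + 0 ℤ.≤ coordSum p → + 0 ℤ.≤ coordSum (end origin w₁ ⊕ p)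
  shift {p} le = subst (+ 0 ℤ.≤_)
    (sym (trans (coordSum-⊕ (end origin w₁) p) (trans (cong (ℤ._+ coordSum p) e₁) (ℤₚ.+-identityˡ _)))) le

prefix-≥ : ∀ u v → InHalfPlane (u ++ v) → + 0 ℤ.≤ coordSum (end origin u)
prefix-≥ u v h = visited-end origin u (proj₁ (All-visited-++⁻ origin u h))

-- The prefix has already climbed to a height of at least zero, and the total is zero. A subloop
-- that leaves an excursion at its end therefore stands at its own base there.
suffix-≤ : ∀ u v → Excursion (u ++ v) → coordSum (end origin v) ℤ.≤ + 0
suffix-≤ u v (h , e) = ℤₚ.≤-trans (ℤₚ.≤-reflexive (sym (ℤₚ.+-identityˡ _)))
  (ℤₚ.≤-trans (ℤₚ.+-monoˡ-≤ _ (prefix-≥ u v h))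
    (ℤₚ.≤-reflexive (trans (sym (coordSum-⊕ (end origin u) (end origin v))) (trans (cong coordSum (sym (end-++-⊕ u v))) e))))

-- If a subloop crosses the junction, its base point has to be the junction, so
-- its part before the junction is a subloop as well.
std-++ : ∀ {w₁ w₂} → Excursion w₁ → Std w₁ → Std w₂ → Std (w₁ ++ w₂)
std-++ {w₁} {w₂} ex h₁ h₂ u v t eq ne l with cut-++ u (v ++ t) w₁ w₂ eq
... | right r _ e = h₂ r v t e ne l
... | left r refl e with cut-++ v t r w₂ (sym e)
...   | left r′ e′ _ = h₁ u v r′ (cong (u ++_) e′) ne l
...   | right r′ refl e′ = go r refl
  where
  base : end origin r ≡ origin
  base = ⊑∧coordSum≤⇒≡ (visited-end origin r (proj₁ (All-visited-++⁻ origin r (proj₂ l)))) (suffix-≤ u r ex)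

  go : ∀ r₀ → r₀ ≡ r → head (r₀ ++ r′) ≡ just N
  go []       refl = h₂ [] r′ t e′ ne l
  go (s ∷ r₀) refl = h₁ u r [] (cong (u ++_) (++-identityʳ r)) (λ ()) (proj₁ (loop-split r l base))

std-N∷ : ∀ {w} → Std w → Std (N ∷ w)
std-N∷ h []      []      t eq   ne l = contradiction refl ne
std-N∷ h []      (N ∷ v) t refl ne l = refl
std-N∷ h (_ ∷ u) v       t refl ne l = h u v t refl ne l

-- New subloops can only start at the added step, and `away` keeps them from closing. For `N` no
-- such condition arises, as the new subloops begin with `N`.
std-∷ : ∀ {s w} → (∀ v t → v ++ t ≡ w → end origin (s ∷ v) ≢ origin) → Std w → Std (s ∷ w)
std-∷ away h []      []      t eq   ne l = contradiction refl ne
std-∷ away h []      (_ ∷ v) t refl ne l = contradiction (proj₁ l) (away v t refl)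
std-∷ away h (_ ∷ u) v       t refl ne l = h u v t refl ne l

-- Up steps, down steps and eagerness

data Up : Step → Set where
  N : Up N
  E : Up E

data Down : Step → Set where
  S : Down S
  W : Down W

coordSum-step-up : ∀ p {s} → Up s → coordSum (step p s) ≡ coordSum p ℤ.+ + 1
coordSum-step-up (x , y) N = sym (ℤₚ.+-assoc x y _)
coordSum-step-up (x , y) E = lemma x y
  where
  lemma : ∀ x y → x ℤ.+ + 1 ℤ.+ y ≡ x ℤ.+ y ℤ.+ + 1
  lemma = ℤSolver.solve-∀

coordSum-step-down : ∀ p {s} → Down s → coordSum (step p s) ≡ coordSum p ℤ.- + 1
coordSum-step-down (x , y) S = sym (ℤₚ.+-assoc x y _)
coordSum-step-down (x , y) W = lemma x y
  where
  lemma : ∀ x y → x ℤ.- + 1 ℤ.+ y ≡ x ℤ.+ y ℤ.- + 1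
  lemma = ℤSolver.solve-∀

up⊎down : ∀ s → Up s ⊎ Down s
up⊎down N = inj₁ N
up⊎down E = inj₁ E
up⊎down S = inj₂ S
up⊎down W = inj₂ W

first-up : ∀ {w s} → InHalfPlane w → head w ≡ just s → Up s
first-up {N ∷ w} h refl = N
first-up {E ∷ w} h refl = E
first-up {S ∷ w} (_ ∷ h) refl with () ← visited-start _ w h
first-up {W ∷ w} (_ ∷ h) refl with () ← visited-start _ w h

i<1+i : ∀ i → i ℤ.< + 1 ℤ.+ i
i<1+i i = ℤₚ.suc[i]≤j⇒i<j ℤₚ.≤-refl

i+1≰i : ∀ i → ¬ (i ℤ.+ + 1 ℤ.≤ i)
i+1≰i i le = ℤₚ.<⇒≱ (i<1+i i) (ℤₚ.≤-trans (ℤₚ.≤-reflexive (ℤₚ.+-comm (+ 1) i)) le)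

-- The final height is minimal, whereas a last step upwards would start below it.
last-down-from : ∀ a w {s} → All (λ p → coordSum (end a w) ℤ.≤ coordSum p) (visited a w) →
                 last w ≡ just s → Down s
last-down-from a (s ∷ []) (h ∷ _) refl with up⊎down s
... | inj₂ d = d
... | inj₁ u = contradiction
  (ℤₚ.≤-trans (ℤₚ.≤-reflexive (sym (coordSum-step-up a u))) h) (i+1≰i (coordSum a))
last-down-from a (s ∷ t ∷ w) (_ ∷ h) eq = last-down-from (step a s) (t ∷ w) h eq

last-down : ∀ {w s} → Excursion w → last w ≡ just s → Down s
last-down {w} (h , e) = last-down-from origin w (All.map (ℤₚ.≤-trans (ℤₚ.≤-reflexive e)) h)

step-moves : ∀ s → step origin s ≢ origin
step-moves N ()
step-moves E ()
step-moves S ()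
step-moves W ()

std-[] : Std []
std-[] [] [] _ _ ne _ = contradiction refl ne

std-[_] : ∀ s → Std [ s ]
std-[ s ] = std-∷ (λ { [] _ _ → step-moves s ; (_ ∷ _) _ () }) std-[]

EagerPair : Step → Step → Set
EagerPair s t = ¬ (s ≡ E × t ≡ S) × ¬ (s ≡ N × t ≡ W)

-- Both forbidden pairs go up and then down, so eagerness can fail only at a peak, never at the
-- junction of two excursions.
eagerPair-up : ∀ {s t} → Up t → EagerPair s t
eagerPair-up N = (λ { (_ , ()) }) , λ { (_ , ()) }
eagerPair-up E = (λ { (_ , ()) }) , λ { (_ , ()) }

eagerPair-down : ∀ {s t} → Down s → EagerPair s t
eagerPair-down S = (λ { (() , _) }) , λ { (() , _) }
eagerPair-down W = (λ { (() , _) }) , λ { (() , _) }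

eager-∷ : ∀ {s w} → (∀ {t} → head w ≡ just t → EagerPair s t) → Eager w → Eager (s ∷ w)
eager-∷ h []       = [-]
eager-∷ h [-]      = h refl ∷ [-]
eager-∷ h (e ∷ es) = h refl ∷ e ∷ es

eager-++ : ∀ {u v} → (∀ {s t} → last u ≡ just s → head v ≡ just t → EagerPair s t) →
           Eager u → Eager v → Eager (u ++ v)
eager-++ h []       ev = ev
eager-++ h [-]      ev = eager-∷ (h refl) ev
eager-++ h (e ∷ es) ev = e ∷ eager-++ h es ev

eager-++⁻ : ∀ u {v} → Eager (u ++ v) → Eager u × Eager v
eager-++⁻ []          e       = [] , e
eager-++⁻ (s ∷ [])    e       = [-] , Linked.tail e
eager-++⁻ (s ∷ t ∷ u) (p ∷ e) = let e₁ , e₂ = eager-++⁻ (t ∷ u) e in p ∷ e₁ , e₂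

-- BigWalk in terms of properties that do not mention a starting point
record Big (w : Walk) : Set where
  constructor big
  field
    std       : Std w
    eager     : Eager w
    excursion : Excursion w

open Big

big-++ : ∀ {w₁ w₂} → Big w₁ → Big w₂ → Big (w₁ ++ w₂)
big-++ (big s₁ e₁ x₁) (big s₂ e₂ x₂) = big (std-++ x₁ s₁ s₂)
  (eager-++ (λ _ eq → eagerPair-up (first-up (proj₁ x₂) eq)) e₁ e₂) (excursion-++ x₁ x₂)

BigWalk⇒Big : ∀ {w} → BigWalk w → Big w
BigWalk⇒Big (s , e , h , x , eq) =
  big (Standard⇒Std s) e (h , trans (cong coordSum eq) (ℤₚ.+-inverseʳ x))

coordSum≡0⇒antidiagonal : ∀ p → coordSum p ≡ + 0 → p ≡ (proj₁ p , ℤ.- proj₁ p)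
coordSum≡0⇒antidiagonal (x , y) eq = cong (x ,_) (begin
  y                     ≡⟨ lemma x y ⟩
  ℤ.- x ℤ.+ (x ℤ.+ y)   ≡⟨ cong (λ i → ℤ.- x ℤ.+ i) eq ⟩
  ℤ.- x ℤ.+ + 0         ≡⟨ ℤₚ.+-identityʳ _ ⟩
  ℤ.- x                 ∎)
  where
  open ≡-Reasoning
  lemma : ∀ x y → y ≡ ℤ.- x ℤ.+ (x ℤ.+ y)
  lemma = ℤSolver.solve-∀

Big⇒BigWalk : ∀ {w} → Big w → BigWalk w
Big⇒BigWalk (big s e (h , eq)) =
  Std⇒Standard s , e , h , _ , coordSum≡0⇒antidiagonal _ eq

bracket : Step → Walk → Step → Walk
bracket s w t = s ∷ w ++ [ t ]

excursion-bracket : ∀ {s w t} → Up s → Down t → Excursion w → Excursion (bracket s w t)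
excursion-bracket {s} {w} {t} u d (h , e) =
  (ℤₚ.≤-refl ∷ All-visited-++ a w
     (All-visited-from a w (All.map (λ {p} → raise p) h))
     (subst (+ 0 ℤ.≤_) (sym at-top) (ℤ.+≤+ z≤n) ∷ ℤₚ.≤-reflexive (sym at-bottom) ∷ [])) ,
  trans (cong coordSum (end-++ a w [ t ])) at-bottom
  where
  a = step origin s
  sum-a : ∀ p → coordSum (a ⊕ p) ≡ + 1 ℤ.+ coordSum p
  sum-a p = trans (coordSum-⊕ a p) (cong (ℤ._+ coordSum p) (coordSum-step-up origin u))
  raise : ∀ p → + 0 ℤ.≤ coordSum p → + 0 ℤ.≤ coordSum (a ⊕ p)
  raise p le = subst (+ 0 ℤ.≤_) (sym (sum-a p)) (ℤₚ.≤-trans le (ℤₚ.i≤j+i _ (+ 1)))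
  at-top : coordSum (end a w) ≡ + 1
  at-top = trans (cong coordSum (end-from a w)) (trans (sum-a _) (cong (λ i → + 1 ℤ.+ i) e))
  at-bottom : coordSum (step (end a w) t) ≡ + 0
  at-bottom = trans (coordSum-step-down _ d) (cong (λ i → i ℤ.- + 1) at-top)

-- A nonempty excursion begins upwards and ends downwards, which makes both new pairs harmless. Only
-- around an empty one do the brackets meet.
eager-bracket : ∀ {s w t} → (w ≡ [] → EagerPair s t) → Excursion w → Eager w → Eager (bracket s w t)
eager-bracket {w = []}        p x e = p refl ∷ [-]
eager-bracket {w = w@(_ ∷ _)} p x e = eager-∷ (λ eq → eagerPair-up (first-up (proj₁ x) eq))
  (eager-++ (λ eq _ → eagerPair-down (last-down x eq)) e [-])

NS-pair : EagerPair N S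
NS-pair = (λ { (() , _) }) , λ { (_ , ()) }

lift : Walk → Walk
lift w = bracket N w S

big-bracket-N : ∀ {w t} → Down t → (w ≡ [] → EagerPair N t) → Big w → Big (bracket N w t)
big-bracket-N {w} {t} d p (big s e x) =
  big (std-N∷ (std-++ x s std-[ t ])) (eager-bracket p x e) (excursion-bracket N d x)

big-lift : ∀ {w} → Big w → Big (lift w)
big-lift = big-bracket-N S (λ _ → NS-pair)

-- No subloop starts with the added `E`, because the walk never returns to its origin: its height
-- stays at least one until the last step, and as `w` is closed that step leads to `(1 , -1)`.
big-bracket-ES : ∀ {w} → w ≢ [] → end origin w ≡ origin → Big w → Big (bracket E w S)
big-bracket-ES {w} ne eo (big s e x) =
  big (std-∷ away (std-++ x s std-[ S ])) (eager-bracket (λ eq → contradiction eq ne) x e)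
      (excursion-bracket E S x)
  where
  a = step origin E
  away : ∀ v t → v ++ t ≡ w ++ [ S ] → end a v ≢ origin
  away v t eq back with cut-++ v t w [ S ] eq
  ... | left r refl _ = contradiction (prefix-≥ v r (proj₁ x)) (ℤₚ.<⇒≱ (begin-strict
      coordSum (end origin v)            <⟨ i<1+i _ ⟩
      + 1 ℤ.+ coordSum (end origin v)    ≡⟨ coordSum-⊕ a (end origin v) ⟨
      coordSum (a ⊕ end origin v)        ≡⟨ cong coordSum (end-from a v) ⟨
      coordSum (end a v)                 ≡⟨ cong coordSum back ⟩
      + 0                                ∎))
    where open ℤₚ.≤-Reasoning
  ... | right [] refl _ with () ← trans (sym (trans (cong (end a) (++-identityʳ w)) (trans (end-from a w) (cong (a ⊕_) eo)))) back
  ... | right (_ ∷ []) refl refl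
        with () ← trans (sym (trans (end-++ a w [ S ]) (cong (λ q → step q S) (trans (end-from a w) (cong (a ⊕_) eo))))) back

-- Each use of wrap lowers the excursion below the axes by one; the inner lift
-- only keeps the E of the wrapping from meeting its S.
wrap : Walk → Walk
wrap w = bracket N (bracket E (lift w) S) W

end-bracket : ∀ s w t → end origin (bracket s w t) ≡ step (step origin s ⊕ end origin w) t
end-bracket s w t = trans (end-++ (step origin s) w [ t ]) (cong (λ q → step q t) (end-from (step origin s) w))

end-lift : ∀ {w} → end origin w ≡ origin → end origin (lift w) ≡ origin
end-lift {w} eq = trans (end-bracket N w S) (cong (λ q → step (step origin N ⊕ q) S) eq)

end-wrap : ∀ {w} → end origin w ≡ origin → end origin (wrap w) ≡ origin
end-wrap {w} eq = trans (end-bracket N (bracket E (lift w) S) W) (cong (λ q → step (step origin N ⊕ q) W)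
  (trans (end-bracket E (lift w) S) (cong (λ q → step (step origin E ⊕ q) S) (end-lift {w} eq))))

big-wrap : ∀ {w} → end origin w ≡ origin → Big w → Big (wrap w)
big-wrap {w} eq b = big-bracket-N W (λ ()) (big-bracket-ES (λ ()) (end-lift {w} eq) (big-lift b))

-- Mirroring the part of a walk outside its loops

-- A step together with the possibly empty loop performed right after it.
Token : Set
Token = Step × Walk

flat : List Token → Walk
flat []             = []
flat ((s , l) ∷ ts) = s ∷ l ++ flat ts

flat-++ : ∀ ts us → flat (ts ++ us) ≡ flat ts ++ flat us
flat-++ []             us = refl
flat-++ ((s , l) ∷ ts) us =
  cong (s ∷_) (trans (cong (l ++_) (flat-++ ts us)) (sym (++-assoc l (flat ts) (flat us))))

skeleton : List Token → Walk
skeleton = map proj₁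

Loops : List Token → Set
Loops = All (Loop ∘ proj₂)

LoopFree : Walk → Set
LoopFree w = ∀ u v t → u ++ v ++ t ≡ w → v ≢ [] → ¬ Loop v

-- A form of loop erasure in which only QP-subloops are erased and each is remembered at the step it
-- follows.
Irreducible : List Token → Set
Irreducible ts = Loops ts × LoopFree (skeleton ts)

loopFree-tail : ∀ {s w} → LoopFree (s ∷ w) → LoopFree w
loopFree-tail f u v t eq = f (_ ∷ u) v t (cong (_ ∷_) eq)

loopFree-drop : ∀ u {w} → LoopFree (u ++ w) → LoopFree w
loopFree-drop []      f = f
loopFree-drop (_ ∷ u) f = loopFree-drop u (loopFree-tail f)

irreducible-tail : ∀ {t ts} → Irreducible (t ∷ ts) → Irreducible ts
irreducible-tail (_ ∷ ls , f) = ls , loopFree-tail f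

end-skeleton : ∀ a {ts} → Loops ts → end a (skeleton ts) ≡ end a (flat ts)
end-skeleton a                  []       = refl
end-skeleton a {(s , l) ∷ ts} (h ∷ hs) =
  trans (end-skeleton (step a s) hs)
    (sym (trans (end-++ (step a s) l (flat ts))
      (cong (λ q → end q (flat ts)) (proj₁ (loop-at (step a s) h)))))

-- Every point of a loop dominates its base, and the skeleton visits that base.
visited-flat : ∀ {P : Point → Set} → (∀ {p q} → p ⊑ q → P p → P q) →
               ∀ a {ts} → Loops ts → All P (visited a (skeleton ts)) → All P (visited a (flat ts))
visited-flat     up a                []       vs       = vs
visited-flat {P} up a {(s , l) ∷ ts} (h ∷ hs) (v ∷ vs) =
  v ∷ All-visited-++ {P} a′ l (All.map (λ le → up le (visited-start a′ (skeleton ts) vs)) (proj₂ h′))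
        (subst (λ q → All P (visited q (flat ts))) (sym (proj₁ h′)) (visited-flat up a′ hs vs))
  where
  a′ = step a s
  h′ = loop-at a′ h

-- The base point of a loop inside l lies both above and below the base point of l.
skeleton-prefix : ∀ a {ts r t} → Loops ts → r ++ t ≡ flat ts → r ≢ [] →
  end a r ≡ origin → All (origin ⊑_) (visited a r) →
  ∃[ u ] ∃[ v ] u ++ v ≡ skeleton ts × u ≢ [] ×
    end a u ≡ origin × All (origin ⊑_) (visited a u)
skeleton-prefix a {ts}           {[]}    hs eq ne e vs = contradiction refl ne
skeleton-prefix a {(s , l) ∷ ts} {x ∷ r} {t} (h ∷ hs) eq ne e (v ∷ vs) with ∷-injective eq
... | refl , eq′ with cut-++ r t l (flat ts) eq′
...   | left m refl _ = [ s ] , skeleton ts , refl , (λ ()) , a′≡origin , v ∷ ⊑-reflexive ∷ []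
  where
  a′ = step a s
  a′≡origin : a′ ≡ origin
  a′≡origin = ⊑-antisym
    (subst (a′ ⊑_) e (visited-end a′ r (proj₁ (All-visited-++⁻ a′ r (proj₂ (loop-at a′ h))))))
    (visited-start a′ r vs)
  ⊑-reflexive : origin ⊑ a′
  ⊑-reflexive = visited-start a′ r vs
...   | right [] refl _ = [ s ] , skeleton ts , refl , (λ ()) ,
  trans (sym (proj₁ (loop-at (step a s) h))) (trans (cong (end (step a s)) (sym (++-identityʳ l))) e) ,
  v ∷ visited-start (step a s) (l ++ []) vs ∷ []
...   | right (y ∷ r′) refl eq″ =
  let a′ = step a s
      back = proj₁ (loop-at a′ h)
      u , w , eqᵤ , _ , eᵤ , vᵤ = skeleton-prefix a′ {ts} {y ∷ r′} {t} hs eq″ (λ ())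
        (trans (sym (trans (end-++ a′ l (y ∷ r′)) (cong (λ q → end q (y ∷ r′)) back))) e)
        (subst (λ q → All (origin ⊑_) (visited q (y ∷ r′))) back (proj₂ (All-visited-++⁻ a′ l vs)))
  in s ∷ u , w , cong (s ∷_) eqᵤ , (λ ()) , eᵤ , v ∷ vᵤ

no-loop-prefix : ∀ {ts r t} → Irreducible ts → r ++ t ≡ flat ts → r ≢ [] → ¬ Loop r
no-loop-prefix (hs , free) eq ne (e , vs) =
  let u , v , eqᵤ , neᵤ , eᵤ , vᵤ = skeleton-prefix origin hs eq ne e vs
  in free [] u v eqᵤ neᵤ (eᵤ , vᵤ)

-- An occurrence of `v` inside one single loop, the initial one or that of a token. The steps of the
-- skeleton do not enter, so the notion is stable under mirroring.
data Factor (v : Walk) : Walk → List Token → Set where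
  here  : ∀ {l ts} u t → u ++ v ++ t ≡ l → Factor v l ts
  there : ∀ {l s l′ ts} → Factor v l′ ts → Factor v l ((s , l′) ∷ ts)

-- A subloop cannot start right after a loop `l`, as it would leave a loop in the skeleton. Nor can
-- it start inside `l` and run beyond it: at the end of `l` it would be back at its base, and its
-- remainder would be a subloop starting right there.
loop-factor : ∀ {l ts} u v t → Loop l → Irreducible ts → u ++ v ++ t ≡ l ++ flat ts →
              v ≢ [] → Loop v → Factor v l ts
loop-factor {l} {ts} u v t h irr eq ne lv with cut-++ u (v ++ t) l (flat ts) eq
loop-factor {l} {ts} u v t h irr eq ne lv | right [] _ eq′ =
  contradiction lv (no-loop-prefix irr eq′ ne)
loop-factor {l} {(s , l′) ∷ ts} u v t h irr@(h′ ∷ hs , f) eq ne lv | right (x ∷ r) _ eq′ =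
  there (loop-factor r v t h′ (irreducible-tail irr) (proj₂ (∷-injective eq′)) ne lv)
loop-factor {l} {ts} u v t h irr eq ne lv | left r refl eq′ with cut-++ v t r (flat ts) (sym eq′)
... | left r′ refl _ = here u r′ refl
... | right [] refl _ = here u [] (cong (u ++_) (trans (++-identityʳ _) (++-identityʳ r)))
... | right r′@(_ ∷ _) refl eq″ = contradiction (proj₂ (loop-split r lv base)) (no-loop-prefix irr eq″ (λ ()))
  where
  base : end origin r ≡ origin
  base = ⊑∧coordSum≤⇒≡ (visited-end origin r (proj₁ (All-visited-++⁻ origin r (proj₂ lv))))
    (suffix-≤ u r (Loop⇒Excursion h))

-- If one initial loop were longer, its excess over the other would again be a loop, standing at the
-- front of the other token list, which `no-loop-prefix` forbids.
flat-unique : ∀ l ts l′ ts′ → Loop l → Loop l′ → Irreducible ts → Irreducible ts′ →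
              l ++ flat ts ≡ l′ ++ flat ts′ → l ≡ l′ × ts ≡ ts′
flat-unique l ts l′ ts′ h h′ irr irr′ eq = l≡l′ , tails ts ts′ irr irr′
    (++-cancelˡ l _ _ (trans eq (cong (_++ flat ts′) (sym l≡l′))))
  where
  longer : ∀ {l ts l′ ts′} r → Loop l → Loop l′ → Irreducible ts′ → l′ ++ r ≡ l → r ++ flat ts ≡ flat ts′ → l ≡ l′
  longer []      h h′ irr refl e = ++-identityʳ _
  longer {l′ = l′} r@(_ ∷ _) h h′ irr refl e =
    contradiction (proj₂ (loop-split l′ {r} h (proj₁ h′))) (no-loop-prefix {r = r} irr e (λ ()))

  l≡l′ : l ≡ l′
  l≡l′ with cut-++ l (flat ts) l′ (flat ts′) eq
  ... | left r e e′  = sym (longer r h′ h irr e e′)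
  ... | right r e e′ = longer r h h′ irr′ e e′

  tails : ∀ ts ts′ → Irreducible ts → Irreducible ts′ → flat ts ≡ flat ts′ → ts ≡ ts′
  tails []             []               irr irr′ e = refl
  tails ((s , k) ∷ ts) ((s′ , k′) ∷ ts′) irr@(g ∷ _ , _) irr′@(g′ ∷ _ , _) e with ∷-injective e
  ... | refl , e′ with flat-unique k ts k′ ts′ g g′ (irreducible-tail irr) (irreducible-tail irr′) e′
  ... | refl , refl = refl

record Decomposition (w : Walk) : Set where
  constructor decomposition
  field
    {loop}      : Walk
    {tokens}    : List Token
    isLoop      : Loop loop
    irreducible : Irreducible tokens
    recompose   : loop ++ flat tokens ≡ w

map-split : ∀ {A B : Set} (f : A → B) xs u v → u ++ v ≡ map f xs →
            ∃[ ys ] ∃[ zs ] ys ++ zs ≡ xs × map f ys ≡ u × map f zs ≡ v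
map-split f xs       []      v eq = [] , xs , refl , refl , sym eq
map-split f (x ∷ xs) (_ ∷ u) v eq with ∷-injective eq
... | refl , eq′ with map-split f xs u v eq′
...   | ys , zs , refl , refl , eq″ = x ∷ ys , zs , refl , refl , eq″

-- Induction from the back. If the new first step forms a loop with some prefix of the skeleton, the
-- step, the old initial loop and the tokens of that prefix merge into the new initial loop.
-- Otherwise the step becomes a token carrying the old initial loop.
decompose : ExcludedMiddle 0ℓ → ∀ w → Decomposition w
decompose em [] = decomposition Loop-[] ([] , λ { [] [] _ _ ne _ → ne refl }) refl
decompose em (s ∷ w) with decompose em w
... | decomposition {l} {ts} h irr@(hs , free) refl
  with em {∃[ u ] ∃[ v ] u ++ v ≡ skeleton ts × Loop (s ∷ u)}
...   | no ¬loop = decomposition {tokens = (s , l) ∷ ts} Loop-[] (h ∷ hs , free′) refl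
  where
  free′ : LoopFree (s ∷ skeleton ts)
  free′ []      []      t eq   ne lv = ne refl
  free′ []      (_ ∷ v) t eq   ne lv with ∷-injective eq
  ... | refl , eq′ = ¬loop (v , t , eq′ , lv)
  free′ (_ ∷ u) v       t eq   ne lv = free u v t (proj₂ (∷-injective eq)) ne lv
...   | yes (u , v , eq , lp) with map-split proj₁ ts u v eq
...     | us , vs , refl , refl , refl = decomposition {tokens = vs}
  ( trans (sym (end-skeleton origin merged)) (proj₁ lp)
  , visited-flat (λ le le′ → ⊑-trans le′ le) origin merged (proj₂ lp) )
  (Allₚ.++⁻ʳ us hs , loopFree-drop u (subst LoopFree (sym eq) free))
  (cong (s ∷_) (trans (++-assoc l (flat us) (flat vs)) (cong (l ++_) (sym (flat-++ us vs)))))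
  where
  merged : Loops ((s , l) ∷ us)
  merged = h ∷ Allₚ.++⁻ˡ us hs

-- Reflection of the skeleton

mirror : Step → Step
mirror N = E
mirror E = N
mirror S = W
mirror W = S

mirror-involutive : ∀ s → mirror (mirror s) ≡ s
mirror-involutive N = refl
mirror-involutive E = refl
mirror-involutive S = refl
mirror-involutive W = refl

mirror-injective : ∀ {s t} → mirror s ≡ mirror t → s ≡ t
mirror-injective {s} {t} eq =
  trans (sym (mirror-involutive s)) (trans (cong mirror eq) (mirror-involutive t))

swapᵖ : Point → Point
swapᵖ (x , y) = y , x

step-mirror : ∀ p s → step (swapᵖ p) (mirror s) ≡ swapᵖ (step p s)
step-mirror p N = refl
step-mirror p E = refl
step-mirror p S = refl
step-mirror p W = refl

end-mirror : ∀ p w → end (swapᵖ p) (map mirror w) ≡ swapᵖ (end p w)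
end-mirror p []      = refl
end-mirror p (s ∷ w) = trans (cong (λ q → end q (map mirror w)) (step-mirror p s)) (end-mirror (step p s) w)

visited-mirror : ∀ {P : Point → Set} p w → All (P ∘ swapᵖ) (visited p w) → All P (visited (swapᵖ p) (map mirror w))
visited-mirror     p []      (h ∷ []) = h ∷ []
visited-mirror {P} p (s ∷ w) (h ∷ hs) =
  h ∷ subst (λ q → All P (visited q (map mirror w))) (sym (step-mirror p s)) (visited-mirror (step p s) w hs)

loop-mirror : ∀ {v} → Loop v → Loop (map mirror v)
loop-mirror {v} (e , h) =
  trans (end-mirror origin v) (cong swapᵖ e) , visited-mirror origin v (All.map (λ { (a , b) → b , a }) h)

loopFree-mirror : ∀ {w} → LoopFree w → LoopFree (map mirror w)
loopFree-mirror {w} f u v t eq ne lv with map-split mirror w u (v ++ t) eq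
... | u′ , r , refl , refl , eq₁ with map-split mirror r v t (sym eq₁)
...   | v′ , t′ , refl , refl , _ = f u′ v′ t′ refl (ne ∘ cong (map mirror))
  (subst Loop (trans (sym (map-∘ v′)) (trans (map-cong mirror-involutive v′) (map-id v′))) (loop-mirror lv))

mirrorTokens : List Token → List Token
mirrorTokens = map (map₁ mirror)

skeleton-mirror : ∀ ts → skeleton (mirrorTokens ts) ≡ map mirror (skeleton ts)
skeleton-mirror ts = trans (sym (map-∘ ts)) (map-∘ ts)

irreducible-mirror : ∀ {ts} → Irreducible ts → Irreducible (mirrorTokens ts)
irreducible-mirror {ts} (hs , f) =
  Allₚ.map⁺ hs , subst LoopFree (sym (skeleton-mirror ts)) (loopFree-mirror f)

length-flat-mirror : ∀ ts → length (flat (mirrorTokens ts)) ≡ length (flat ts)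
length-flat-mirror []             = refl
length-flat-mirror ((s , l) ∷ ts) = cong suc (trans (length-++ l)
  (trans (cong (length l ℕ.+_) (length-flat-mirror ts)) (sym (length-++ l))))

visited-flat⁻ : ∀ {P : Point → Set} a {ts} → Loops ts → All P (visited a (flat ts)) → All P (visited a (skeleton ts))
visited-flat⁻     a                []       vs       = vs
visited-flat⁻ {P} a {(s , l) ∷ ts} (h ∷ hs) (v ∷ vs) =
  v ∷ visited-flat⁻ (step a s) hs
    (subst (λ q → All P (visited q (flat ts))) (proj₁ (loop-at (step a s) h)) (proj₂ (All-visited-++⁻ (step a s) l vs)))

factor-mirror : ∀ {v l ts} → Factor v l (mirrorTokens ts) → Factor v l ts
factor-mirror {ts = []}    (here u t eq) = here u t eq
factor-mirror {ts = _ ∷ _} (here u t eq) = here u t eq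
factor-mirror {ts = _ ∷ _} (there f)     = there (factor-mirror f)

factor-split : ∀ {v l ts} → Factor v l ts → ∃[ u ] ∃[ t ] u ++ v ++ t ≡ l ++ flat ts
factor-split {v} {ts = ts} (here u t refl) = u , t ++ flat ts ,
  trans (cong (u ++_) (sym (++-assoc v t (flat ts)))) (sym (++-assoc u (v ++ t) (flat ts)))
factor-split {v} {l} {(s , _) ∷ _} (there f) with factor-split f
... | u , t , eq = l ++ s ∷ u , t , trans (++-assoc l (s ∷ u) (v ++ t)) (cong (λ z → l ++ s ∷ z) eq)

-- The reflection exchanges `E S` with `N W`.
eagerPair-mirror : ∀ {s t} → EagerPair s t → EagerPair (mirror s) (mirror t)
eagerPair-mirror {s} {t} (¬ES , ¬NW) =
  (λ (p , q) → ¬NW (mirror-injective p , mirror-injective q)) ,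
  (λ (p , q) → ¬ES (mirror-injective p , mirror-injective q))

head-loop-up : ∀ {l s} → Loop l → head l ≡ just s → Up s
head-loop-up h = first-up (proj₁ (Loop⇒Excursion h))

-- Two skeleton steps are adjacent only across an empty loop, and then both are mirrored. A nonempty
-- loop begins upwards and ends downwards, so it tolerates any neighbour.
eager-mirror : ∀ {ts} → Loops ts → Eager (flat ts) → Eager (flat (mirrorTokens ts))
eager-mirror []                             e = []
eager-mirror {(s , [])    ∷ []}             (h ∷ hs) e = [-]
eager-mirror {(s , [])    ∷ (s′ , l) ∷ ts} (h ∷ hs) e =
  eager-∷ (λ { refl → eagerPair-mirror (Linked.head e) }) (eager-mirror hs (Linked.tail e))
eager-mirror {(s , l@(x ∷ _)) ∷ ts}        (h ∷ hs) e =
  let e₁ , e₂ = eager-++⁻ l (Linked.tail e)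
  in eager-∷ (λ { refl → eagerPair-up (head-loop-up h refl) })
       (eager-++ (λ eq _ → eagerPair-down (last-down (Loop⇒Excursion h) eq)) e₁ (eager-mirror hs e₂))

module Flip (em : ExcludedMiddle 0ℓ) where

  -- Mirroring everything outside the loops mirrors the end point, and the
  -- loops, which are kept, are those that have to start with N.
  flip : Walk → Walk
  flip w = let open Decomposition (decompose em w) in loop ++ flat (mirrorTokens tokens)

  flip-injective : ∀ {w w′} → flip w ≡ flip w′ → w ≡ w′
  flip-injective {w} {w′} eq with decompose em w | decompose em w′
  ... | decomposition {l} {ts} h irr refl | decomposition {l′} {ts′} h′ irr′ refl
      with flat-unique l _ l′ _ h h′ (irreducible-mirror irr) (irreducible-mirror irr′) eq
  ... | refl , eq′ = cong (λ us → l ++ flat us) (map-injective inj eq′)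
    where
    inj : ∀ {t t′ : Token} → map₁ mirror t ≡ map₁ mirror t′ → t ≡ t′
    inj e = cong₂ _,_ (mirror-injective (cong proj₁ e)) (cong proj₂ e)

  length-flip : ∀ w → length (flip w) ≡ length w
  length-flip w with decompose em w
  ... | decomposition {l} {ts} _ _ refl =
    trans (length-++ l) (trans (cong (length l ℕ.+_) (length-flat-mirror ts)) (sym (length-++ l)))

  end-flip : ∀ w → end origin (flip w) ≡ swapᵖ (end origin w)
  end-flip w with decompose em w
  ... | decomposition {l} {ts} h (hs , _) refl = begin
    end origin (l ++ flat (mirrorTokens ts))          ≡⟨ skip (mirrorTokens ts) ⟩
    end origin (flat (mirrorTokens ts))               ≡⟨ end-skeleton origin (Allₚ.map⁺ hs) ⟨
    end origin (skeleton (mirrorTokens ts))           ≡⟨ cong (end origin) (skeleton-mirror ts) ⟩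
    end origin (map mirror (skeleton ts))             ≡⟨ end-mirror origin (skeleton ts) ⟩
    swapᵖ (end origin (skeleton ts))                  ≡⟨ cong swapᵖ (end-skeleton origin hs) ⟩
    swapᵖ (end origin (flat ts))                      ≡⟨ cong swapᵖ (skip ts) ⟨
    swapᵖ (end origin (l ++ flat ts))                 ∎
    where
    open ≡-Reasoning
    skip : ∀ us → end origin (l ++ flat us) ≡ end origin (flat us)
    skip us = trans (end-++ origin l (flat us)) (cong (λ q → end q (flat us)) (proj₁ h))

  -- A subloop of the flipped walk sits inside one of the kept loops, hence occurs in the original
  -- walk too.
  std-flip : ∀ {w} → Std w → Std (flip w)
  std-flip {w} st u v t eq ne lv with decompose em w
  ... | decomposition h irr refl
      with factor-split (factor-mirror (loop-factor u v t h (irreducible-mirror irr) eq ne lv))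
  ...   | u′ , t′ , eq′ = st u′ v t′ eq′ ne lv

  eager-flip : ∀ {w} → Eager w → Eager (flip w)
  eager-flip {w} e with decompose em w
  ... | decomposition {l} {ts} h (hs , _) refl =
    let e₁ , e₂ = eager-++⁻ l e
    in eager-++ (λ eq _ → eagerPair-down (last-down (Loop⇒Excursion h) eq)) e₁ (eager-mirror hs e₂)

  -- Heights are invariant under the reflection, and the loops never go below the height of the
  -- skeleton point they are attached to.
  halfPlane-flip : ∀ {w} → InHalfPlane w → InHalfPlane (flip w)
  halfPlane-flip {w} p with decompose em w
  ... | decomposition {l} {ts} h (hs , _) refl =
    All-visited-++ origin l (proj₁ (Loop⇒Excursion h))
      (subst (λ q → All HP (visited q (flat (mirrorTokens ts)))) (sym (proj₁ h))
        (visited-flat {HP} (λ le le′ → ℤₚ.≤-trans le′ (coordSum-mono le)) origin (Allₚ.map⁺ hs)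
          (subst (λ z → All HP (visited origin z)) (sym (skeleton-mirror ts))
            (visited-mirror {HP} origin (skeleton ts)
              (All.map (λ {q} → subst (+ 0 ℤ.≤_) (ℤₚ.+-comm (proj₁ q) (proj₂ q)))
                (visited-flat⁻ origin hs
                  (subst (λ q → All HP (visited q (flat ts))) (proj₁ h) (proj₂ (All-visited-++⁻ origin l p)))))))))
    where
    HP : Point → Set
    HP p = + 0 ℤ.≤ coordSum p

  big-flip : ∀ {w} → Big w → Big (flip w)
  big-flip {w} (big s e (h , eq)) = big (std-flip s) (eager-flip e)
    ( halfPlane-flip h
    , trans (cong coordSum (end-flip w)) (trans (ℤₚ.+-comm (proj₂ (end origin w)) (proj₁ (end origin w))) eq) )

-- Walks near the corner of the quarter-plane

corner : ℕ → Point
corner k = ℤ.- (+ k) , ℤ.- (+ k)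

Above : Point → Walk → Set
Above c w = All (c ⊑_) (visited origin w)

Box : ℕ → Walk → Set
Box k = Above (corner k)

corner⊑origin : ∀ k → corner k ⊑ origin
corner⊑origin k = ℤₚ.neg-≤-pos {k} , ℤₚ.neg-≤-pos {k}

above-++ : ∀ {c u v} → end origin u ≡ origin → Above c u → Above c v → Above c (u ++ v)
above-++ {c} {u} {v} eq h₁ h₂ =
  All-visited-++ origin u h₁ (subst (λ q → All (c ⊑_) (visited q v)) (sym eq) h₂)

above-bracket : ∀ {c c′ s w t} → c′ ⊑ origin → c′ ⊑ step origin s ⊕ c → c′ ⊑ end origin (bracket s w t) →
                Above c w → Above c′ (bracket s w t)
above-bracket {c} {c′} {s} {w} {t} le le′ le″ h =
  le ∷ All-visited-++ {c′ ⊑_} a w shifted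
    (visited-end {c′ ⊑_} a w shifted ∷ subst (c′ ⊑_) (end-++ a w [ t ]) le″ ∷ [])
  where
  a = step origin s
  shifted : All (c′ ⊑_) (visited a w)
  shifted = All-visited-from a w (All.map (λ h → ⊑-trans le′ (⊕-mono-⊑ a h)) h)

box-wrap : ∀ {k w} → end origin w ≡ origin → Box (suc k) w → Box k (wrap w)
box-wrap {k} {w} eq h = above-bracket {corner⁻} {corner k} {N} {bracket E (lift w) S} {W}
  (corner⊑origin k) (x≤0+x , 1-sk)
  (subst (corner k ⊑_) (sym (end-wrap {w} eq)) (corner⊑origin k))
  (above-bracket {corner (suc k)} {corner⁻} {E} {lift w} {S} (ℤₚ.neg-≤-pos {k} , ℤ.-≤+) (1-sk , x≤0+x)
    (subst (corner⁻ ⊑_) (sym end-E) (ℤₚ.neg-≤-pos {k} , ℤ.-≤- z≤n))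
    (above-bracket {corner (suc k)} {corner (suc k)} {N} {w} {S} (corner⊑origin (suc k))
      (x≤0+x , ℤₚ.i≤j+i _ (+ 1))
      (subst (corner (suc k) ⊑_) (sym (end-lift {w} eq)) (corner⊑origin (suc k))) h))
  where
  -- The corner between the two outer brackets: `E` has moved the walk one column to the right, and
  -- the outer `N` has yet to move it one row up.
  corner⁻ : Point
  corner⁻ = ℤ.- (+ k) , ℤ.- (+ suc k)
  x≤0+x : ∀ {i} → i ℤ.≤ + 0 ℤ.+ i
  x≤0+x {i} = ℤₚ.≤-reflexive (sym (ℤₚ.+-identityˡ i))
  1-sk : ℤ.- (+ k) ℤ.≤ + 1 ℤ.+ ℤ.- (+ suc k)
  1-sk = ℤₚ.≤-reflexive (lemma k)
    where
    lemma : ∀ k → ℤ.- (+ k) ≡ + 1 ℤ.+ ℤ.- (+ suc k)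
    lemma zero    = refl
    lemma (suc k) = refl
  end-E : end origin (bracket E (lift w) S) ≡ (+ 1 , ℤ.- (+ 1))
  end-E = trans (end-bracket E (lift w) S) (cong (λ q → step (step origin E ⊕ q) S) (end-lift {w} eq))

-- The slack c, n bounds how far the remaining n steps can descend.
above-length : ∀ n c p w → length w ≤ n → c ⊕ (+ n , + n) ⊑ p → All (c ⊑_) (visited p w)
above-length n c p [] le h = ⊑-trans (ℤₚ.i≤i+j _ (+ n) , ℤₚ.i≤i+j _ (+ n)) h ∷ []
above-length (suc n) c p (s ∷ w) (s≤s le) h =
  ⊑-trans (ℤₚ.i≤i+j _ (+ suc n) , ℤₚ.i≤i+j _ (+ suc n)) h ∷
  above-length n c (step p s) w le (slack s)
  where
  pred : ∀ i {j} → i ℤ.+ + suc n ℤ.≤ j → i ℤ.+ + n ℤ.≤ j ℤ.- + 1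
  pred i {j} le = subst (ℤ._≤ j ℤ.- + 1) (lemma i (+ n)) (ℤₚ.+-monoˡ-≤ (ℤ.- (+ 1)) le)
    where
    lemma : ∀ i m → i ℤ.+ (+ 1 ℤ.+ m) ℤ.- + 1 ≡ i ℤ.+ m
    lemma = ℤSolver.solve-∀
  weaken : ∀ i {j} → i ℤ.+ + suc n ℤ.≤ j → i ℤ.+ + n ℤ.≤ j
  weaken i le = ℤₚ.≤-trans (pred i le) (ℤₚ.i-j≤i _ (+ 1))
  up : ∀ i {j} → i ℤ.+ + suc n ℤ.≤ j → i ℤ.+ + n ℤ.≤ j ℤ.+ + 1
  up i le = ℤₚ.≤-trans (weaken i le) (ℤₚ.i≤i+j _ (+ 1))
  slack : ∀ s → c ⊕ (+ n , + n) ⊑ step p s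
  slack N = weaken (proj₁ c) (proj₁ h) , up (proj₂ c) (proj₂ h)
  slack E = up (proj₁ c) (proj₁ h) , weaken (proj₂ c) (proj₂ h)
  slack S = weaken (proj₁ c) (proj₁ h) , pred (proj₂ c) (proj₂ h)
  slack W = pred (proj₁ c) (proj₁ h) , weaken (proj₂ c) (proj₂ h)

box-length : ∀ {k w} → length w ≤ k → Box k w
box-length {k} {w} le = above-length k (corner k) origin w le
  (ℤₚ.≤-reflexive (ℤₚ.+-inverseˡ (+ k)) , ℤₚ.≤-reflexive (ℤₚ.+-inverseˡ (+ k)))

-- Interpolates between 2sip-walks, at `k = 0`, and closed big-walks of any depth. Being closed,
-- such walks can be concatenated at the same `k`.
record Central (k : ℕ) (w : Walk) : Set where
  constructor central
  field
    isBig  : Big w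
    closed : end origin w ≡ origin
    box    : Box k w

central-++ : ∀ {k u v} → Central k u → Central k v → Central k (u ++ v)
central-++ {u = u} {v} (central b₁ e₁ h₁) (central b₂ e₂ h₂) = central (big-++ b₁ b₂)
  (trans (end-++-⊕ u v) (cong₂ _⊕_ e₁ e₂)) (above-++ e₁ h₁ h₂)

central-wrap : ∀ {k w} → Central (suc k) w → Central k (wrap w)
central-wrap {w = w} (central b e h) = central (big-wrap e b) (end-wrap {w} e) (box-wrap e h)

central⇒twoSip : ∀ {w} → Central 0 w → TwoSipWalk w
central⇒twoSip (central (big s e _) eq h) = Std⇒Standard s , e , h , eq

twoSip⇒central : ∀ {k w} → TwoSipWalk w → Central k w
twoSip⇒central {k} (s , e , h , eq) =
  central (big (Standard⇒Std s) e (All.map (λ (a , b) → ℤₚ.+-mono-≤ a b) h , cong coordSum eq)) eq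
    (All.map (⊑-trans (corner⊑origin k)) h)

-- Concatenation and embeddings of the three classes of walks

verticalHappy-++ : ∀ {w₁ w₂} → coordSum (end origin w₁) ≡ + 0 →
                   VerticalHappy w₁ → VerticalHappy w₂ → VerticalHappy (w₁ ++ w₂)
verticalHappy-++ {w₁} {w₂} eq h₁ h₂ u s t e low with cut-++ u (s ∷ t) w₁ w₂ e
... | left (_ ∷ r) e₁ refl = h₁ u s r e₁ low
... | left [] refl refl    = h₂ [] s t refl (inj₁ refl)
... | right r refl e₂      = h₂ r s t e₂ (subst (λ i → i ≡ + 0 ⊎ i ≡ + 1) sum-r low)
  where
  sum-r : coordSum (end origin (w₁ ++ r)) ≡ coordSum (end origin r)
  sum-r = trans (cong coordSum (end-++-⊕ w₁ r)) (trans (coordSum-⊕ (end origin w₁) (end origin r))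
    (trans (cong (ℤ._+ coordSum (end origin r)) eq) (ℤₚ.+-identityˡ _)))

deque-++ : ∀ {w₁ w₂} → DequeWalk w₁ → DequeWalk w₂ → DequeWalk (w₁ ++ w₂)
deque-++ (h₁ , b₁) (h₂ , b₂) =
  verticalHappy-++ (proj₂ (Big.excursion (BigWalk⇒Big b₁))) h₁ h₂ ,
  Big⇒BigWalk (big-++ (BigWalk⇒Big b₁) (BigWalk⇒Big b₂))

bigWalk-++ : ∀ {w₁ w₂} → BigWalk w₁ → BigWalk w₂ → BigWalk (w₁ ++ w₂)
bigWalk-++ b₁ b₂ = Big⇒BigWalk (big-++ (BigWalk⇒Big b₁) (BigWalk⇒Big b₂))

twoSip-++ : ∀ {w₁ w₂} → TwoSipWalk w₁ → TwoSipWalk w₂ → TwoSipWalk (w₁ ++ w₂)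
twoSip-++ b₁ b₂ = central⇒twoSip (central-++ (twoSip⇒central b₁) (twoSip⇒central b₂))

twoSip⇒big : ∀ {w} → TwoSipWalk w → BigWalk w
twoSip⇒big b = Big⇒BigWalk (Central.isBig (twoSip⇒central {0} b))

-- Between the leading `N N` and the final `S S` every point has height at least two, so only the
-- added vertical steps can start on the two critical lines.
verticalHappy-lift² : ∀ {w} → InHalfPlane w → VerticalHappy (lift (lift w))
verticalHappy-lift² {w} h []          s t eq low with ∷-injective eq
... | refl , _ = inj₁ refl
verticalHappy-lift² {w} h (_ ∷ [])    s t eq low with ∷-injective (proj₂ (∷-injective eq))
... | refl , _ = inj₁ refl
verticalHappy-lift² {w} h (x ∷ y ∷ u) s t eq low with ∷-injective eq
... | refl , eq₁ with ∷-injective eq₁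
...   | refl , eq₂ with cut-++ u (s ∷ t) w (S ∷ S ∷ []) (trans eq₂ (++-assoc w [ S ] [ S ]))
...     | right []           _ refl = inj₂ refl
...     | right (_ ∷ [])     _ refl = inj₂ refl
...     | right (_ ∷ _ ∷ []) _ ()
...     | left []      _    refl = inj₂ refl
...     | left (_ ∷ r) refl refl = contradiction low (high (prefix-≥ u (s ∷ r) h))
  where
  a : Point
  a = + 0 , + 2
  high : + 0 ℤ.≤ coordSum (end origin u) →
         ¬ (coordSum (end a u) ≡ + 0 ⊎ coordSum (end a u) ≡ + 1)
  high le low with coordSum (end origin u) | le
                 | trans (cong coordSum (end-from a u)) (coordSum-⊕ a (end origin u))
  ... | + m | _ | eq with coordSum (end a u) | eq | low
  ...   | _ | refl | inj₁ ()
  ...   | _ | refl | inj₂ ()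

deque-lift² : ∀ {w} → BigWalk w → DequeWalk (lift (lift w))
deque-lift² {w} bw = verticalHappy-lift² (proj₁ (Big.excursion bg)) , Big⇒BigWalk (big-lift (big-lift bg))
  where bg = BigWalk⇒Big bw

length-bracket : ∀ s w t → length (bracket s w t) ≡ 2 + length w
length-bracket s w t = cong suc (trans (length-++ w) (ℕₚ.+-comm (length w) 1))

bracket-injective : ∀ {s t w w′} → bracket s w t ≡ bracket s w′ t → w ≡ w′
bracket-injective {w = w} {w′} eq = ++-cancelʳ _ w w′ (proj₂ (∷-injective eq))

wrap-injective : ∀ {w w′} → wrap w ≡ wrap w′ → w ≡ w′
wrap-injective eq = bracket-injective (bracket-injective (bracket-injective eq))

length-wrap : ∀ w → length (wrap w) ≡ 6 + length w
length-wrap w = trans (length-bracket N (bracket E (lift w) S) W) (cong (2 ℕ.+_)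
  (trans (length-bracket E (lift w) S) (cong (2 ℕ.+_) (length-bracket N w S))))

-- Counting

private module ℤ+ = GroupProperties (AbelianGroup.group ℤₚ.+-0-abelianGroup)

length-cartesianProductWith : ∀ {A B C : Set} (f : A → B → C) xs ys →
                              length (cartesianProductWith f xs ys) ≡ length xs * length ys
length-cartesianProductWith f []       ys = refl
length-cartesianProductWith f (x ∷ xs) ys = trans (length-++ (map (f x) ys))
  (cong₂ _+_ (length-map (f x) ys) (length-cartesianProductWith f xs ys))

injection⇒length≤ : ∀ {A B : Set} {xs : List A} {ys : List B} (f : A → B) → Unique xs →
  (∀ {x y} → x ∈ xs → y ∈ xs → f x ≡ f y → x ≡ y) → (∀ {x} → x ∈ xs → f x ∈ ys) →
  length xs ≤ length ys
injection⇒length≤ {xs = []}     f _        inj into = z≤n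
injection⇒length≤ {xs = x ∷ xs} f (x∉ ∷ u) inj into with ∈-∃++ (into (here refl))
... | as , bs , refl = ℕₚ.≤-trans
  (s≤s (injection⇒length≤ f u (λ p q → inj (there p) (there q)) into′))
  (ℕₚ.≤-reflexive (trans (cong suc (length-++ as)) (trans (sym (ℕₚ.+-suc _ _)) (sym (length-++ as)))))
  where
  into′ : ∀ {y} → y ∈ xs → f y ∈ as ++ bs
  into′ y∈ with ∈-++⁻ as (into (there y∈))
  ... | inj₁ p         = ∈-++⁺ˡ p
  ... | inj₂ (there p) = ∈-++⁺ʳ as p
  ... | inj₂ (here eq) = contradiction (sym (inj (there y∈) (here refl) eq)) (All.lookup x∉ y∈)

length-filter-¬ : ∀ {A : Set} {P : A → Set} (P? : Decidable P) xs →
                  length xs ≡ length (filter P? xs) + length (filter (¬? ∘ P?) xs)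
length-filter-¬ P? []       = refl
length-filter-¬ P? (x ∷ xs) with P? x
... | yes _ = cong suc (length-filter-¬ P? xs)
... | no  _ = trans (cong suc (length-filter-¬ P? xs)) (sym (ℕₚ.+-suc _ _))

-- Induction on the largest label: its fibre is split off and compared with the fibre found among
-- the rest.
pigeonhole : ∀ {A : Set} (f : A → ℕ) m xs → (∀ {x} → x ∈ xs → f x ≤ m) →
             ∃[ j ] length xs ≤ suc m * length (filter (λ x → f x ℕ.≟ j) xs)
pigeonhole f zero    xs le = 0 , ℕₚ.≤-reflexive (trans (cong length (sym all)) (sym (ℕₚ.*-identityˡ _)))
  where
  all : filter (λ x → f x ℕ.≟ 0) xs ≡ xs
  all = filter-all _ (All.tabulate (λ x∈ → ℕₚ.n≤0⇒n≡0 (le x∈)))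
pigeonhole {A} f (suc m) xs le = pick (pigeonhole f m rest rest≤)
  where
  fibre : ℕ → List A → List A
  fibre j = filter (λ x → f x ℕ.≟ j)
  rest : List A
  rest = filter (λ x → ¬? (f x ℕ.≟ suc m)) xs
  rest≤ : ∀ {x} → x ∈ rest → f x ≤ m
  rest≤ x∈ with ∈-filter⁻ (λ x → ¬? (f x ℕ.≟ suc m)) {xs = xs} x∈
  ... | x∈′ , ne = ℕₚ.≤-pred (ℕₚ.≤∧≢⇒< (le x∈′) ne)
  split : length xs ≡ length (fibre (suc m) xs) + length rest
  split = length-filter-¬ (λ x → f x ℕ.≟ suc m) xs
  smaller : ∀ j → length (fibre j rest) ≤ length (fibre j xs)
  smaller j = length-mono-≤ (filter⁺ (λ x → f x ℕ.≟ j) (λ x → f x ℕ.≟ j) (λ { refl → id }) (filter-⊆ (λ x → ¬? (f x ℕ.≟ suc m)) xs))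
  pick : ∃[ j ] length rest ≤ suc m * length (fibre j rest) →
         ∃[ j ] length xs ≤ suc (suc m) * length (fibre j xs)
  pick (j , h) with ℕₚ.≤-total (length (fibre (suc m) xs)) (length (fibre j xs))
  ... | inj₁ le₁ = j , ℕₚ.≤-trans (ℕₚ.≤-reflexive split)
    (ℕₚ.+-mono-≤ le₁ (ℕₚ.≤-trans h (ℕₚ.*-monoʳ-≤ (suc m) (smaller j))))
  ... | inj₂ le₂ = suc m , ℕₚ.≤-trans (ℕₚ.≤-reflexive split)
    (ℕₚ.+-monoʳ-≤ _ (ℕₚ.≤-trans h (ℕₚ.*-monoʳ-≤ (suc m) (ℕₚ.≤-trans (smaller j) le₂))))

∈-walks : ∀ w → w ∈ walks (length w)
∈-walks []      = here refl
∈-walks (s ∷ w) = ∈-cartesianProductWith⁺ _∷_ (any s) (∈-walks w)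
  where
  any : ∀ s → s ∈ N ∷ E ∷ S ∷ W ∷ []
  any N = here refl
  any E = there (here refl)
  any S = there (there (here refl))
  any W = there (there (there (here refl)))

walks-length : ∀ n {w} → w ∈ walks n → length w ≡ n
walks-length zero    (here refl) = refl
walks-length (suc n) w∈ with ∈-cartesianProductWith⁻ _∷_ (N ∷ E ∷ S ∷ W ∷ []) (walks n) w∈
... | s , v , _ , v∈ , refl = cong suc (walks-length n v∈)

walks-unique : ∀ n → Unique (walks n)
walks-unique zero    = [] ∷ []
walks-unique (suc n) = Uniqueₚ.cartesianProductWith⁺ _∷_ ∷-injective
  (((λ ()) ∷ (λ ()) ∷ (λ ()) ∷ []) ∷ ((λ ()) ∷ (λ ()) ∷ []) ∷ ((λ ()) ∷ []) ∷ [] ∷ []) (walks-unique n)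

length-walks : ∀ n → length (walks n) ≡ 4 ^ n
length-walks zero    = refl
length-walks (suc n) = trans (length-cartesianProductWith _∷_ (N ∷ E ∷ S ∷ W ∷ []) (walks n)) (cong (4 *_) (length-walks n))

module _ {P : Walk → Set} (P? : Decidable P) where

  count : ℕ → ℕ
  count n = length (filter P? (walks n))

  unique-filter : ∀ n → Unique (filter P? (walks n))
  unique-filter n = Uniqueₚ.filter⁺ P? (walks-unique n)

  ∈-count⁺ : ∀ {n w} → P w → length w ≡ n → w ∈ filter P? (walks n)
  ∈-count⁺ {w = w} pw refl = ∈-filter⁺ P? (∈-walks w) pw

  ∈-count⁻ : ∀ n {w} → w ∈ filter P? (walks n) → length w ≡ n × P w
  ∈-count⁻ n w∈ = let w∈′ , pw = ∈-filter⁻ P? {xs = walks n} w∈ in walks-length n w∈′ , pw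

  count≤4^ : ∀ n → count n ≤ 4 ^ n
  count≤4^ n = ℕₚ.≤-trans (length-filter P? (walks n)) (ℕₚ.≤-reflexive (length-walks n))

++-injective : ∀ (u u′ : Walk) {v v′} → length u ≡ length u′ → u ++ v ≡ u′ ++ v′ → u ≡ u′ × v ≡ v′
++-injective []      []       _  eq = refl , eq
++-injective (_ ∷ u) (_ ∷ u′) le eq with ∷-injective eq
... | refl , eq′ with ++-injective u u′ (ℕₚ.suc-injective le) eq′
...   | refl , eq″ = refl , eq″

-- The fixed length of the first factor shows where to cut, so the concatenation determines the
-- pair.
product-≤-count : ∀ {P : Walk → Set} (P? : Decidable P) m n {xs ys} (f : Walk → Walk) →
  (∀ {w w′} → f w ≡ f w′ → w ≡ w′) → Unique xs → Unique ys →
  (∀ {u} → u ∈ xs → length u ≡ m) → (∀ {v} → v ∈ ys → length (f v) ≡ n) →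
  (∀ {u v} → u ∈ xs → v ∈ ys → P (u ++ f v)) → length xs * length ys ≤ count P? (m + n)
product-≤-count P? m n {xs} {ys} f inj ux uy lx ly ok =
  ℕₚ.≤-trans (ℕₚ.≤-reflexive (sym (length-cartesianProductWith _,_ xs ys)))
    (injection⇒length≤ (λ (u , v) → u ++ f v) (Uniqueₚ.cartesianProduct⁺ ux uy) inj′ into)
  where
  inj′ : ∀ {p q} → p ∈ cartesianProduct xs ys → q ∈ cartesianProduct xs ys →
         proj₁ p ++ f (proj₂ p) ≡ proj₁ q ++ f (proj₂ q) → p ≡ q
  inj′ {u , _} {u′ , _} p∈ q∈ eq with ∈-cartesianProduct⁻ xs ys p∈ | ∈-cartesianProduct⁻ xs ys q∈
  ... | u∈ , _ | u′∈ , _ with ++-injective u u′ (trans (lx u∈) (sym (lx u′∈))) eq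
  ...   | refl , eq′ = cong (_ ,_) (inj eq′)
  into : ∀ {p} → p ∈ cartesianProduct xs ys → proj₁ p ++ f (proj₂ p) ∈ filter P? (walks (m + n))
  into {u , v} p∈ with ∈-cartesianProduct⁻ xs ys p∈
  ... | u∈ , v∈ = ∈-count⁺ P? (ok u∈ v∈) (trans (length-++ u) (cong₂ _+_ (lx u∈) (ly v∈)))

count-* : ∀ {P : Walk → Set} (P? : Decidable P) → (∀ {u v} → P u → P v → P (u ++ v)) →
          ∀ m n → count P? m * count P? n ≤ count P? (m + n)
count-* P? closed m n = product-≤-count P? m n id id (unique-filter P? m) (unique-filter P? n)
  (proj₁ ∘ ∈-count⁻ P? m) (proj₁ ∘ ∈-count⁻ P? n)
  (λ u∈ v∈ → closed (proj₂ (∈-count⁻ P? m u∈)) (proj₂ (∈-count⁻ P? n v∈)))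

count-mono : ∀ {P Q : Walk → Set} (P? : Decidable P) (Q? : Decidable Q) c (f : Walk → Walk) →
  (∀ {w w′} → f w ≡ f w′ → w ≡ w′) → (∀ w → length (f w) ≡ c + length w) →
  (∀ {w} → P w → Q (f w)) → ∀ n → count P? n ≤ count Q? (c + n)
count-mono P? Q? c f inj len ok n = injection⇒length≤ f (unique-filter P? n) (λ _ _ → inj)
  λ {w} w∈ → let l , pw = ∈-count⁻ P? n w∈ in ∈-count⁺ Q? (ok pw) (trans (len w) (cong (λ k → c + k) l))


-- Inequalities between the counts

half-+ : ∀ m n → 2 * m + 2 * n ≡ 2 * (m + n)
half-+ m n = sym (ℕₚ.*-distribˡ-+ 2 m n)

SuperMultiplicative : (ℕ → ℕ) → Set
SuperMultiplicative f = ∀ m n → f m * f n ≤ f (m + n)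

count-even-* : ∀ {P : Walk → Set} (P? : Decidable P) → (∀ {u v} → P u → P v → P (u ++ v)) →
               SuperMultiplicative (λ n → count P? (2 * n))
count-even-* P? closed m n =
  ℕₚ.≤-trans (count-* P? closed (2 * m) (2 * n)) (ℕₚ.≤-reflexive (cong (count P?) (half-+ m n)))

count-even-mono : ∀ {P Q : Walk → Set} (P? : Decidable P) (Q? : Decidable Q) c (f : Walk → Walk) →
  (∀ {w w′} → f w ≡ f w′ → w ≡ w′) → (∀ w → length (f w) ≡ 2 * c + length w) →
  (∀ {w} → P w → Q (f w)) → ∀ n → count P? (2 * n) ≤ count Q? (2 * (c + n))
count-even-mono P? Q? c f inj len ok n =
  ℕₚ.≤-trans (count-mono P? Q? (2 * c) f inj len ok (2 * n)) (ℕₚ.≤-reflexive (cong (count Q?) (half-+ c n)))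

p-* : SuperMultiplicative p
p-* = count-even-* twoSipWalk? twoSip-++

d-* : SuperMultiplicative d
d-* = count-even-* dequeWalk? deque-++

b-* : SuperMultiplicative b
b-* = count-even-* bigWalk? bigWalk-++

p≤b : ∀ n → p n ≤ b n
p≤b = count-even-mono twoSipWalk? bigWalk? 0 id id (λ _ → refl) twoSip⇒big

d≤b : ∀ n → d n ≤ b n
d≤b = count-even-mono dequeWalk? bigWalk? 0 id id (λ _ → refl) proj₂

b≤d : ∀ n → b n ≤ d (2 + n)
b≤d = count-even-mono bigWalk? dequeWalk? 2 (lift ∘ lift) (bracket-injective ∘ bracket-injective)
  (λ w → trans (length-bracket N (lift w) S) (cong (λ k → 2 + k) (length-bracket N w S))) deque-lift²

b≤16^ : ∀ n → b n ≤ 16 ^ n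
b≤16^ n = ℕₚ.≤-trans (count≤4^ bigWalk? (2 * n)) (ℕₚ.≤-reflexive (sym (ℕₚ.^-*-assoc 4 2 n)))

module CentralWalks (em : ExcludedMiddle 0ℓ) where

  open Flip em

  central? : ∀ k → Decidable (Central k)
  central? k w = em

  c : ℕ → ℕ → ℕ
  c k n = count (central? k) (2 * n)

  c-* : ∀ k → SuperMultiplicative (c k)
  c-* k = count-even-* (central? k) central-++

  p≤c : ∀ k n → p n ≤ c k n
  p≤c k = count-even-mono twoSipWalk? (central? k) 0 id id (λ _ → refl) twoSip⇒central

  -- Each of the `k` wraps adds six steps, that is three to the half-length.
  c≤p : ∀ k n → c k n ≤ p (k * 3 + n)
  c≤p zero    n = count-even-mono (central? 0) twoSipWalk? 0 id id (λ _ → refl) central⇒twoSip n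
  c≤p (suc k) n = ℕₚ.≤-trans
    (count-even-mono (central? (suc k)) (central? k) 3 wrap wrap-injective length-wrap central-wrap n)
    (ℕₚ.≤-trans (c≤p k (3 + n)) (ℕₚ.≤-reflexive (cong p
      (trans (sym (ℕₚ.+-assoc (k * 3) 3 n)) (cong (_+ n) (ℕₚ.+-comm (k * 3) 3))))))

  -- There are at most `4 n + 1` possible end points, so some class of big-walks with a common end
  -- point holds at least that fraction of all. Its pairs give the walks `u ++ flip v`, whose `4 n`
  -- steps can descend by at most `4 n`.
  b²≤c : ∀ n → b n * b n ≤ suc (4 * n) * suc (4 * n) * c (4 * n) (2 * n)
  b²≤c n = main (pigeonhole label (4 * n) bigs label≤)
    where
    bigs : List Walk
    bigs = filter bigWalk? (walks (2 * n))
    -- The end point has first coordinate at least −2n, so ∣_∣ does not identify labels.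
    label : Walk → ℕ
    label w = ℤ.∣ proj₁ (end origin w) ℤ.+ + (2 * n) ∣
    in-box : ∀ {w} → w ∈ bigs → corner (2 * n) ⊑ end origin w
    in-box {w} w∈ = visited-end origin w (box-length (ℕₚ.≤-reflexive (proj₁ (∈-count⁻ bigWalk? (2 * n) w∈))))
    label-sound : ∀ {w} → w ∈ bigs → + label w ≡ proj₁ (end origin w) ℤ.+ + (2 * n)
    label-sound w∈ = ℤₚ.0≤i⇒+∣i∣≡i (ℤₚ.≤-trans (ℤₚ.≤-reflexive (sym (ℤₚ.+-inverseˡ (+ (2 * n)))))
      (ℤₚ.+-monoˡ-≤ (+ (2 * n)) (proj₁ (in-box w∈))))
    antidiagonal : ∀ {w} → w ∈ bigs → end origin w ≡ (proj₁ (end origin w) , ℤ.- proj₁ (end origin w))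
    antidiagonal w∈ = coordSum≡0⇒antidiagonal _
      (proj₂ (Big.excursion (BigWalk⇒Big (proj₂ (∈-count⁻ bigWalk? (2 * n) w∈)))))
    label≤ : ∀ {w} → w ∈ bigs → label w ≤ 4 * n
    label≤ {w} w∈ = ℤₚ.drop‿+≤+ (begin
      + label w                                 ≡⟨ label-sound w∈ ⟩
      proj₁ (end origin w) ℤ.+ + (2 * n)        ≤⟨ ℤₚ.+-monoˡ-≤ (+ (2 * n)) x≤ ⟩
      + (2 * n) ℤ.+ + (2 * n)                   ≡⟨ cong +_ (sym (ℕₚ.*-distribʳ-+ n 2 2)) ⟩
      + (4 * n)                                 ∎)
      where
      open ℤₚ.≤-Reasoning
      x≤ : proj₁ (end origin w) ℤ.≤ + (2 * n)
      x≤ = ℤₚ.neg-cancel-≤ (subst (ℤ.- (+ (2 * n)) ℤ.≤_) (cong proj₂ (antidiagonal w∈)) (proj₂ (in-box w∈)))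
    fibre : ℕ → List Walk
    fibre j = filter (λ w → label w ℕ.≟ j) bigs
    pair-central : ∀ {j u v} → u ∈ fibre j → v ∈ fibre j → Central (4 * n) (u ++ flip v)
    pair-central {j} {u} {v} u∈ v∈ with ∈-filter⁻ (λ w → label w ℕ.≟ j) {xs = bigs} u∈
                                      | ∈-filter⁻ (λ w → label w ℕ.≟ j) {xs = bigs} v∈
    ... | u∈′ , refl | v∈′ , eq = central
      (big-++ (BigWalk⇒Big (proj₂ (∈-count⁻ bigWalk? (2 * n) u∈′)))
              (big-flip (BigWalk⇒Big (proj₂ (∈-count⁻ bigWalk? (2 * n) v∈′)))))
      (trans (end-++-⊕ u (flip v)) (trans (cong₂ _⊕_ (antidiagonal u∈′) (trans (end-flip v) (cong swapᵖ (antidiagonal v∈′))))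
        (trans (cong (λ x → (proj₁ (end origin u) , ℤ.- proj₁ (end origin u)) ⊕ (ℤ.- x , x)) same)
          (cong₂ _,_ (ℤₚ.+-inverseʳ x₀) (ℤₚ.+-inverseˡ x₀)))))
      (box-length (ℕₚ.≤-reflexive (trans (length-++ u) (trans (cong₂ _+_ (proj₁ (∈-count⁻ bigWalk? (2 * n) u∈′))
        (trans (length-flip v) (proj₁ (∈-count⁻ bigWalk? (2 * n) v∈′)))) (sym (ℕₚ.*-distribʳ-+ n 2 2))))))
      where
      x₀ = proj₁ (end origin u)
      same : proj₁ (end origin v) ≡ x₀
      same = ℤ+.∙-cancelʳ (+ (2 * n)) _ _ (trans (sym (label-sound v∈′)) (trans (cong +_ eq) (label-sound u∈′)))
    pairs : ∀ j → length (fibre j) * length (fibre j) ≤ c (4 * n) (2 * n)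
    pairs j = ℕₚ.≤-trans
      (product-≤-count (central? (4 * n)) (2 * n) (2 * n) flip flip-injective unique unique
        (λ u∈ → proj₁ (member u∈)) (λ {v} v∈ → trans (length-flip v) (proj₁ (member v∈))) pair-central)
      (ℕₚ.≤-reflexive (cong (count (central? (4 * n)))
        (trans (half-+ n n) (cong (λ k → 2 * (n + k)) (sym (ℕₚ.+-identityʳ n))))))
      where
      unique = Uniqueₚ.filter⁺ (λ w → label w ℕ.≟ j) (unique-filter bigWalk? (2 * n))
      member : ∀ {w} → w ∈ fibre j → length w ≡ 2 * n × BigWalk w
      member w∈ = ∈-count⁻ bigWalk? (2 * n) (proj₁ (∈-filter⁻ (λ w → label w ℕ.≟ j) {xs = bigs} w∈))
    main : ∃[ j ] length bigs ≤ suc (4 * n) * length (fibre j) →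
           b n * b n ≤ suc (4 * n) * suc (4 * n) * c (4 * n) (2 * n)
    main (j , h) = begin
      b n * b n                                                  ≤⟨ ℕₚ.*-mono-≤ h h ⟩
      suc (4 * n) * length (fibre j) * (suc (4 * n) * length (fibre j)) ≡⟨ ℕₚ.[m*n]*[o*p]≡[m*o]*[n*p] (suc (4 * n)) (length (fibre j)) (suc (4 * n)) (length (fibre j)) ⟩
      suc (4 * n) * suc (4 * n) * (length (fibre j) * length (fibre j)) ≤⟨ ℕₚ.*-monoʳ-≤ (suc (4 * n) * suc (4 * n)) (pairs j) ⟩
      suc (4 * n) * suc (4 * n) * c (4 * n) (2 * n)              ∎
      where open ℕₚ.≤-Reasoning

-- Found by evaluation; the empty walk and `N S` are the walks counted.
p-pos : 1 ≤ p 0 × 1 ≤ p 1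
p-pos = s≤s z≤n , s≤s z≤n

d-pos : 1 ≤ d 0 × 1 ≤ d 1
d-pos = s≤s z≤n , s≤s z≤n

-- Exponential growth of supermultiplicative sequences

-- Bernoulli's inequality `1 + q / a ≤ (1 + 1 / a) ^ q` with denominators cleared.
bernoulli : ∀ a q → a ^ q * (a + q) ≤ a * suc a ^ q
bernoulli a zero    = ℕₚ.≤-reflexive (lemma a)
  where
  lemma : ∀ a → 1 * (a + 0) ≡ a * 1
  lemma = ℕSolver.solve-∀
bernoulli a (suc q) = begin
  a * a ^ q * (a + suc q)               ≤⟨ ℕₚ.m≤m+n _ (a ^ q * q) ⟩
  a * a ^ q * (a + suc q) + a ^ q * q   ≡⟨ lemma a (a ^ q) q ⟩
  suc a * (a ^ q * (a + q))             ≤⟨ ℕₚ.*-monoʳ-≤ (suc a) (bernoulli a q) ⟩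
  suc a * (a * suc a ^ q)               ≡⟨ lemma′ a (suc a) (suc a ^ q) ⟩
  a * (suc a * suc a ^ q)               ∎
  where
  open ℕₚ.≤-Reasoning
  lemma : ∀ a x q → a * x * (a + (1 + q)) + x * q ≡ (1 + a) * (x * (a + q))
  lemma = ℕSolver.solve-∀
  lemma′ : ∀ a b y → b * (a * y) ≡ a * (b * y)
  lemma′ = ℕSolver.solve-∀

bernoulli-< : ∀ {a b} → a < b → ∀ q → a ^ q * (a + q) ≤ a * b ^ q
bernoulli-< {a} a<b q = ℕₚ.≤-trans (bernoulli a q) (ℕₚ.*-monoʳ-≤ a (ℕₚ.^-monoˡ-≤ q a<b))

-- By Bernoulli `(b / a) ^ q` is at least `1 + q / a`, which exceeds `c` once `q` exceeds `c * a`.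
exponential-dominates : ∀ c {a b} → a < b → ∀ {q} → suc (c * a) ≤ q → c * a ^ q < b ^ q
exponential-dominates c {zero} {b} a<b {suc q} le =
  subst (_< b ^ suc q) (sym (ℕₚ.*-zeroʳ c)) (ℕₚ.m^n>0 b {{>-nonZero a<b}} (suc q))
exponential-dominates c {a@(suc _)} {b} a<b {q} le = ℕₚ.*-cancelˡ-< a _ _ (begin-strict
  a * (c * a ^ q)   ≡⟨ lemma a c (a ^ q) ⟩
  a ^ q * (c * a)   <⟨ ℕₚ.*-monoʳ-< (a ^ q) {{ℕₚ.m^n≢0 a q}} (ℕₚ.≤-trans le (ℕₚ.m≤n+m q a)) ⟩
  a ^ q * (a + q)   ≤⟨ bernoulli-< a<b q ⟩
  a * b ^ q         ∎)
  where
  open ℕₚ.≤-Reasoning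
  lemma : ∀ a c x → a * (c * x) ≡ x * (c * a)
  lemma = ℕSolver.solve-∀

Outgrows : (ℕ → ℕ) → ℕ → Set
Outgrows f u = ∃[ m ] ∀ n → m ≤ n → u ^ n < f n

module _ {f : ℕ → ℕ} (f-* : SuperMultiplicative f) where

  positive-values : 1 ≤ f 0 → 1 ≤ f 1 → ∀ n → 1 ≤ f n
  positive-values f₀ f₁ zero    = f₀
  positive-values f₀ f₁ (suc n) = ℕₚ.≤-trans (ℕₚ.*-mono-≤ f₁ (positive-values f₀ f₁ n)) (f-* 1 n)

  power-≤ : 1 ≤ f 0 → ∀ n q → f n ^ q ≤ f (q * n)
  power-≤ f₀ n zero    = f₀
  power-≤ f₀ n (suc q) = ℕₚ.≤-trans (ℕₚ.*-monoʳ-≤ (f n) (power-≤ f₀ n q)) (f-* n (q * n))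

  -- Division of `n` by `M` with quotient `q`: supermultiplicativity yields `f n ≥ (v ^ M) ^ q`,
  -- whereas `u ^ n` is at most a constant times `(u ^ M) ^ q`. For large `q` the ratio of the bases
  -- outweighs the constant.
  fekete : 1 ≤ f 0 → 1 ≤ f 1 → ∀ {u v} M .{{_ : NonZero M}} → u < v → v ^ M ≤ f M → Outgrows f u
  fekete f₀ f₁ {u} {v} M u<v v^M≤ = q₀ * M , λ n le → begin-strict
    u ^ n                              ≡⟨ cong (u ^_) (m≡m%n+[m/n]*n n M) ⟩
    u ^ (n % M + n / M * M)            ≡⟨ ℕₚ.^-distribˡ-+-* u (n % M) (n / M * M) ⟩
    u ^ (n % M) * u ^ (n / M * M)      ≡⟨ cong (λ k → u ^ (n % M) * u ^ k) (ℕₚ.*-comm (n / M) M) ⟩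
    u ^ (n % M) * u ^ (M * (n / M))    ≡⟨ cong (u ^ (n % M) *_) (ℕₚ.^-*-assoc u M (n / M)) ⟨
    u ^ (n % M) * (u ^ M) ^ (n / M)    ≤⟨ ℕₚ.*-monoˡ-≤ _ (ℕₚ.≤-trans (ℕₚ.^-monoˡ-≤ (n % M) (ℕₚ.n≤1+n u)) (ℕₚ.^-monoʳ-≤ (suc u) (m%n≤n n M))) ⟩
    C * (u ^ M) ^ (n / M)              <⟨ exponential-dominates C (ℕₚ.^-monoˡ-< M u<v)
                                            (ℕₚ.≤-trans (ℕₚ.≤-reflexive (sym (m*n/n≡m q₀ M))) (/-monoˡ-≤ M le)) ⟩
    (v ^ M) ^ (n / M)                  ≤⟨ ℕₚ.^-monoˡ-≤ (n / M) v^M≤ ⟩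
    f M ^ (n / M)                      ≤⟨ power-≤ f₀ M (n / M) ⟩
    f (n / M * M)                      ≡⟨ ℕₚ.*-identityˡ _ ⟨
    1 * f (n / M * M)                  ≤⟨ ℕₚ.*-monoˡ-≤ _ (positive-values f₀ f₁ (n % M)) ⟩
    f (n % M) * f (n / M * M)          ≤⟨ f-* (n % M) (n / M * M) ⟩
    f (n % M + n / M * M)              ≡⟨ cong f (m≡m%n+[m/n]*n n M) ⟨
    f n                                ∎
    where
    open ℕₚ.≤-Reasoning
    -- The base `suc u` is positive even for `u = 0`, so the exponent may be raised from the
    -- remainder to `M`.
    C = suc u ^ M
    q₀ = suc (C * u ^ M)

outgrows-shift : ∀ {f g : ℕ → ℕ} K → (∀ n → f n ≤ g (K + n)) → ∀ {s t} → s < t → Outgrows f t →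
                 ∃[ M ] NonZero M × s ^ M ≤ g M
outgrows-shift {f} {g} K f≤g {s} {t} s<t (m , h) = K + n , >-nonZero (ℕₚ.≤-trans (s≤s z≤n) (ℕₚ.m≤n+m n K)) , (begin
  s ^ (K + n)     ≡⟨ ℕₚ.^-distribˡ-+-* s K n ⟩
  s ^ K * s ^ n   ≤⟨ ℕₚ.<⇒≤ (exponential-dominates (s ^ K) s<t (ℕₚ.m≤m+n _ m)) ⟩
  t ^ n           ≤⟨ ℕₚ.<⇒≤ (h n (ℕₚ.m≤n+m m _)) ⟩
  f n             ≤⟨ f≤g n ⟩
  g (K + n)       ∎)
  where
  open ℕₚ.≤-Reasoning
  -- The first summand makes `(t / s) ^ n` exceed the cost `s ^ K` of the shift; the second makes
  -- `f` outgrow `t`.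
  n = suc (s ^ K * s) + m

-- Comparing `a n` with powers of a fraction `u / w` amounts to comparing `a n * w ^ n` with powers
-- of `u`, and the weighting preserves supermultiplicativity.
module Weighted (w : ℕ) .{{_ : NonZero w}} where

  weighted : (ℕ → ℕ) → ℕ → ℕ
  weighted a n = a n * w ^ n

  weighted-* : ∀ {a} → SuperMultiplicative a → SuperMultiplicative (weighted a)
  weighted-* {a} a-* m n = begin
    a m * w ^ m * (a n * w ^ n)     ≡⟨ ℕₚ.[m*n]*[o*p]≡[m*o]*[n*p] (a m) (w ^ m) (a n) (w ^ n) ⟩
    a m * a n * (w ^ m * w ^ n)     ≡⟨ cong (a m * a n *_) (ℕₚ.^-distribˡ-+-* w m n) ⟨
    a m * a n * w ^ (m + n)         ≤⟨ ℕₚ.*-monoˡ-≤ _ (a-* m n) ⟩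
    a (m + n) * w ^ (m + n)         ∎
    where open ℕₚ.≤-Reasoning

  weighted-pos : ∀ {a} n → 1 ≤ a n → 1 ≤ weighted a n
  weighted-pos n h = ℕₚ.*-mono-≤ h (ℕₚ.m^n>0 w n)

  weighted-shift : ∀ {a a′ : ℕ → ℕ} K → (∀ n → a n ≤ a′ (K + n)) → ∀ n → weighted a n ≤ weighted a′ (K + n)
  weighted-shift K h n = ℕₚ.*-mono-≤ (h n) (ℕₚ.^-monoʳ-≤ w (ℕₚ.m≤n+m n K))

  fekete-weighted : ∀ {a} → SuperMultiplicative a → 1 ≤ a 0 → 1 ≤ a 1 →
    ∀ {u v} M .{{_ : NonZero M}} → u < v → v ^ M ≤ weighted a M → Outgrows (weighted a) u
  fekete-weighted {a} a-* a₀ a₁ = fekete (weighted-* {a} a-*) (weighted-pos {a} 0 a₀) (weighted-pos {a} 1 a₁)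

  fekete-shift : ∀ {a a′ : ℕ → ℕ} K → (∀ n → a n ≤ a′ (K + n)) →
    SuperMultiplicative a′ → 1 ≤ a′ 0 → 1 ≤ a′ 1 →
    ∀ {u t} → suc u < t → Outgrows (weighted a) t → Outgrows (weighted a′) u
  fekete-shift {a} {a′} K a≤ a-* a₀ a₁ {u} {t} u<t o
    with outgrows-shift {weighted a} {weighted a′} K (weighted-shift {a} {a′} K a≤) u<t o
  ... | M , nz , h = fekete-weighted {a′} a-* a₀ a₁ M {{nz}} (ℕₚ.n<1+n u) h

^-double : ∀ x n → x ^ (2 * n) ≡ x ^ n * x ^ n
^-double x n = trans (cong (λ k → x ^ (n + k)) (ℕₚ.+-identityʳ n)) (ℕₚ.^-distribˡ-+-* x n n)

*-interchange : ∀ i j → i * j * (i * j) ≡ i * i * (j * j)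
*-interchange i j = ℕₚ.[m*n]*[o*p]≡[m*o]*[n*p] i j i j

-- Bernoulli's inequality, squared
square-dominates : ∀ {t s} m l .{{_ : NonZero t}} → t < s → t * t * l ≤ (t + m) * (t + m) →
                   l * t ^ (2 * m) ≤ s ^ (2 * m)
square-dominates {t} {s} m l t<s le = ℕₚ.*-cancelˡ-≤ (t * t) {{ℕₚ.m*n≢0 t t}} (begin
  t * t * (l * t ^ (2 * m))             ≡⟨ ℕₚ.*-assoc (t * t) l (t ^ (2 * m)) ⟨
  t * t * l * t ^ (2 * m)               ≤⟨ ℕₚ.*-monoˡ-≤ (t ^ (2 * m)) le ⟩
  (t + m) * (t + m) * t ^ (2 * m)       ≡⟨ ℕₚ.*-comm ((t + m) * (t + m)) (t ^ (2 * m)) ⟩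
  t ^ (2 * m) * ((t + m) * (t + m))     ≡⟨ cong (_* ((t + m) * (t + m))) (^-double t m) ⟩
  t ^ m * t ^ m * ((t + m) * (t + m))   ≡⟨ *-interchange (t ^ m) (t + m) ⟨
  t ^ m * (t + m) * (t ^ m * (t + m))   ≤⟨ ℕₚ.*-mono-≤ (bernoulli-< t<s m) (bernoulli-< t<s m) ⟩
  t * s ^ m * (t * s ^ m)               ≡⟨ *-interchange t (s ^ m) ⟩
  t * t * (s ^ m * s ^ m)               ≡⟨ cong (t * t *_) (^-double s m) ⟨
  t * t * s ^ (2 * m)                   ∎)
  where open ℕₚ.≤-Reasoning

-- A single Bernoulli bound is only linear in `m`, like the factor `4 n + 1` at `n = 2 m`; its
-- square is quadratic and wins. The constant comes from `8 m + 1 ≤ 9 m`.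
quadratic-dominates : ∀ t m → suc (9 * (t * t)) ≤ m → t * t * suc (4 * (2 * m)) ≤ (t + m) * (t + m)
quadratic-dominates t m le = begin
  k * suc (4 * (2 * m))      ≡⟨ ℕₚ.*-suc k (4 * (2 * m)) ⟩
  k + k * (4 * (2 * m))      ≤⟨ ℕₚ.+-monoˡ-≤ (k * (4 * (2 * m))) (ℕₚ.m≤m*n k m {{>-nonZero (ℕₚ.≤-trans (s≤s z≤n) le)}}) ⟩
  k * m + k * (4 * (2 * m))  ≡⟨ lemma k m ⟩
  9 * k * m                  ≤⟨ ℕₚ.*-monoˡ-≤ m (ℕₚ.≤-trans (ℕₚ.n≤1+n (9 * k)) le) ⟩
  m * m                      ≤⟨ ℕₚ.*-mono-≤ (ℕₚ.m≤n+m m t) (ℕₚ.m≤n+m m t) ⟩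
  (t + m) * (t + m)          ∎
  where
  open ℕₚ.≤-Reasoning
  k = t * t
  lemma : ∀ k m → k * m + k * (4 * (2 * m)) ≡ 9 * k * m
  lemma = ℕSolver.solve-∀

square-bound : ∀ {t s x y} n l .{{_ : NonZero l}} → l * t ^ n ≤ s ^ n → s ^ n ≤ x → x * x ≤ l * l * y →
               t ^ (2 * n) ≤ y
square-bound {t} {s} {x} {y} n l lt≤s s≤x xx≤ = ℕₚ.*-cancelˡ-≤ (l * l) {{ℕₚ.m*n≢0 l l}} (begin
  l * l * t ^ (2 * n)       ≡⟨ cong (l * l *_) (^-double t n) ⟩
  l * l * (t ^ n * t ^ n)   ≡⟨ *-interchange l (t ^ n) ⟨
  l * t ^ n * (l * t ^ n)   ≤⟨ ℕₚ.*-mono-≤ lt≤s lt≤s ⟩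
  s ^ n * s ^ n             ≤⟨ ℕₚ.*-mono-≤ s≤x s≤x ⟩
  x * x                     ≤⟨ xx≤ ⟩
  l * l * y                 ∎)
  where open ℕₚ.≤-Reasoning

-- Comparison of the growth rates, from the inequalities between the counts alone

module Comparison {p d b : ℕ → ℕ} {c : ℕ → ℕ → ℕ}
  (p-* : SuperMultiplicative p) (d-* : SuperMultiplicative d) (b-* : SuperMultiplicative b)
  (c-* : ∀ k → SuperMultiplicative (c k))
  (p₀ : 1 ≤ p 0) (p₁ : 1 ≤ p 1) (d₀ : 1 ≤ d 0) (d₁ : 1 ≤ d 1)
  (p≤b : ∀ n → p n ≤ b n) (b≤d : ∀ n → b n ≤ d (2 + n))
  (p≤c : ∀ k n → p n ≤ c k n) (c≤p : ∀ k n → c k n ≤ p (k * 3 + n))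
  (b²≤c : ∀ n → b n * b n ≤ suc (4 * n) * suc (4 * n) * c (4 * n) (2 * n))
  (w : ℕ) .{{_ : NonZero w}} where

  open Weighted w

  b-outgrows : ∀ {u v} M .{{_ : NonZero M}} → u < v → v ^ M ≤ weighted b M → Outgrows (weighted b) u
  b-outgrows = fekete-weighted {b} b-* (ℕₚ.≤-trans p₀ (p≤b 0)) (ℕₚ.≤-trans p₁ (p≤b 1))

  d-outgrows : ∀ {u t} → suc u < t → Outgrows (weighted b) t → Outgrows (weighted d) u
  d-outgrows = fekete-shift {b} {d} 2 b≤d d-* d₀ d₁

  weighted-b²≤c : ∀ n → weighted b n * weighted b n ≤
                  suc (4 * n) * suc (4 * n) * weighted (c (4 * n)) (2 * n)
  weighted-b²≤c n = go (suc (4 * n)) (b²≤c n)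
    where
    open ℕₚ.≤-Reasoning
    go : ∀ l → b n * b n ≤ l * l * c (4 * n) (2 * n) →
         weighted b n * weighted b n ≤ l * l * weighted (c (4 * n)) (2 * n)
    go l le = begin
      b n * w ^ n * (b n * w ^ n)                   ≡⟨ *-interchange (b n) (w ^ n) ⟩
      b n * b n * (w ^ n * w ^ n)                   ≡⟨ cong (b n * b n *_) (^-double w n) ⟨
      b n * b n * w ^ (2 * n)                       ≤⟨ ℕₚ.*-monoˡ-≤ (w ^ (2 * n)) le ⟩
      l * l * c (4 * n) (2 * n) * w ^ (2 * n)       ≡⟨ ℕₚ.*-assoc (l * l) (c (4 * n) (2 * n)) (w ^ (2 * n)) ⟩
      l * l * (c (4 * n) (2 * n) * w ^ (2 * n))     ∎

  -- The drop from `s` to `t` pays for the polynomial factor in `weighted-b²≤c`. From here on the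
  -- depth `k` is fixed.
  central-value : ∀ {t s} .{{_ : NonZero t}} → t < s → Outgrows (weighted b) s →
                  ∃[ k ] ∃[ M ] NonZero M × t ^ M ≤ weighted (c k) M
  central-value {t} {s} t<s (m₀ , h) =
    go (suc (9 * (t * t)) + m₀) (s≤s z≤n) (ℕₚ.m≤m+n (suc (9 * (t * t))) m₀) (ℕₚ.m≤n+m m₀ (suc (9 * (t * t))))
    where
    go : ∀ m → 1 ≤ m → suc (9 * (t * t)) ≤ m → m₀ ≤ m →
         ∃[ k ] ∃[ M ] NonZero M × t ^ M ≤ weighted (c k) M
    go m 1≤m le m₀≤m = 4 * n , 2 * n , >-nonZero (ℕₚ.≤-trans 1≤n (ℕₚ.m≤m+n n (n + 0))) ,
      square-bound {t} {s} {weighted b n} n (suc (4 * n))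
        (square-dominates m (suc (4 * n)) t<s (quadratic-dominates t m le))
        (ℕₚ.<⇒≤ (h n (ℕₚ.≤-trans m₀≤m (ℕₚ.m≤m+n m (m + 0))))) (weighted-b²≤c n)
      where
      -- Even, so that `s ^ n` is the square of `s ^ m` and Bernoulli can be applied to each factor.
      n = 2 * m
      1≤n = ℕₚ.≤-trans 1≤m (ℕₚ.m≤m+n m (m + 0))

  -- After `central-value` the rate is `3 + u`. Fekete's lemma for `c k` lowers it to `2 + u`, the
  -- shift caused by `k` wraps to `1 + u`, and Fekete's lemma for `p` to `u`.
  p-outgrows : ∀ {u s} → 3 + u < s → Outgrows (weighted b) s → Outgrows (weighted p) u
  p-outgrows {u} {s} u<s o = go (ℕₚ.n<1+n u) (ℕₚ.n<1+n (suc u)) (ℕₚ.n<1+n (2 + u)) (central-value u<s o)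
    where
    go : ∀ {t₁ t₂ t₃} → u < t₁ → t₁ < t₂ → t₂ < t₃ →
         ∃[ k ] ∃[ M ] NonZero M × t₃ ^ M ≤ weighted (c k) M → Outgrows (weighted p) u
    go {t₁} {t₂} {t₃} u<t₁ t₁<t₂ t₂<t₃ (k , M , nz , h) =
      fekete-shift {c k} {p} (k * 3) (c≤p k) p-* p₀ p₁ {u} {t₂} (ℕₚ.≤-trans (s≤s u<t₁) t₁<t₂) (c-outgrows M {{nz}} t₂<t₃ h)
      where
      c-outgrows : ∀ {u v} M .{{_ : NonZero M}} → u < v → v ^ M ≤ weighted (c k) M → Outgrows (weighted (c k)) u
      c-outgrows = fekete-weighted {c k} (c-* k) (ℕₚ.≤-trans p₀ (p≤c k 0)) (ℕₚ.≤-trans p₁ (p≤c k 1))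

-- Rationals and reals

fromℕ-mkℚ : ∀ i → fromℕ i ≡ mkℚ (+ i) 0 (Coprime.sym (Coprime.1-coprimeTo i))
fromℕ-mkℚ i = ℚₚ.normalize-coprime (Coprime.sym (Coprime.1-coprimeTo i))

toℚᵘ-fromℕ : ∀ i → toℚᵘ (fromℕ i) ≡ ℚᵘ.mkℚᵘ (+ i) 0
toℚᵘ-fromℕ i = cong toℚᵘ (fromℕ-mkℚ i)

↥-fromℕ : ∀ i → ↥ (fromℕ i) ≡ + i
↥-fromℕ i = cong ↥_ (fromℕ-mkℚ i)

↧-fromℕ : ∀ i → ↧ (fromℕ i) ≡ + 1
↧-fromℕ i = cong ↧_ (fromℕ-mkℚ i)

*-fromℕ : ∀ r u w → ↥ r ℤ.* + w ≡ + u ℤ.* ↧ r → r ℚ.* fromℕ w ≡ fromℕ u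
*-fromℕ r@record{} u w eq = ℚₚ.toℚᵘ-injective (ℚᵘₚ.≃-trans (ℚₚ.toℚᵘ-homo-* r (fromℕ w))
  (subst₂ (λ x y → toℚᵘ r ℚᵘ.* x ℚᵘ.≃ y) (sym (toℚᵘ-fromℕ w)) (sym (toℚᵘ-fromℕ u)) (ℚᵘ.*≡* cross)))
  where
  cross : ↥ r ℤ.* + w ℤ.* + 1 ≡ + u ℤ.* (+ (suc (ℚ.denominator-1 r) * 1))
  cross = trans (ℤₚ.*-identityʳ _) (trans eq (cong (λ k → + u ℤ.* + k) (sym (ℕₚ.*-identityʳ _))))

fromℕ-* : ∀ i j → fromℕ i ℚ.* fromℕ j ≡ fromℕ (i * j)
fromℕ-* i j = *-fromℕ (fromℕ i) (i * j) j (begin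
  ↥ (fromℕ i) ℤ.* + j                 ≡⟨ cong (ℤ._* + j) (↥-fromℕ i) ⟩
  + i ℤ.* + j                         ≡⟨ ℤₚ.pos-* i j ⟨
  + (i * j)                         ≡⟨ ℤₚ.*-identityʳ _ ⟨
  + (i * j) ℤ.* + 1                 ≡⟨ cong (λ k → + (i * j) ℤ.* k) (↧-fromℕ i) ⟨
  + (i * j) ℤ.* ↧ (fromℕ i)         ∎)
  where open ≡-Reasoning

fromℕ-mono-< : ∀ {i j} → i < j → fromℕ i ℚ.< fromℕ j
fromℕ-mono-< {i} {j} lt rewrite fromℕ-mkℚ i | fromℕ-mkℚ j = ℚ.*<* (ℤₚ.*-monoʳ-<-pos (+ 1) (ℤ.+<+ lt))

fromℕ-mono-≤ : ∀ {i j} → i ≤ j → fromℕ i ℚ.≤ fromℕ j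
fromℕ-mono-≤ {i} {j} le rewrite fromℕ-mkℚ i | fromℕ-mkℚ j = ℚ.*≤* (ℤₚ.*-monoʳ-≤-nonNeg (+ 1) (ℤ.+≤+ le))

fromℕ-cancel-< : ∀ {i j} → fromℕ i ℚ.< fromℕ j → i < j
fromℕ-cancel-< {i} {j} lt with i ℕ.<? j
... | yes i<j = i<j
... | no  i≮j = ⊥-elim (ℚₚ.<-irrefl refl (ℚₚ.<-≤-trans lt (fromℕ-mono-≤ (ℕₚ.≮⇒≥ i≮j))))

fromℕ-suc : ∀ i → fromℕ (suc i) ≡ 1ℚ ℚ.+ fromℕ i
fromℕ-suc i = ℚₚ.toℚᵘ-injective (ℚᵘₚ.≃-trans (ℚᵘₚ.≃-reflexive (toℚᵘ-fromℕ (suc i)))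
  (ℚᵘₚ.≃-sym (ℚᵘₚ.≃-trans (ℚₚ.toℚᵘ-homo-+ 1ℚ (fromℕ i))
    (subst (λ y → toℚᵘ 1ℚ ℚᵘ.+ y ℚᵘ.≃ ℚᵘ.mkℚᵘ (+ suc i) 0) (sym (toℚᵘ-fromℕ i))
      (ℚᵘ.*≡* (cong (ℤ._* + 1) (cong (λ k → + 1 ℤ.+ k) (ℤₚ.*-identityʳ (+ i)))))))))

^-fromℕ : ∀ i n → fromℕ i ^ℚ n ≡ fromℕ (i ^ n)
^-fromℕ i zero    = refl
^-fromℕ i (suc n) = trans (cong (fromℕ i ℚ.*_) (^-fromℕ i n)) (fromℕ-* i (i ^ n))

^-distrib-* : ∀ x y n → (x ℚ.* y) ^ℚ n ≡ x ^ℚ n ℚ.* y ^ℚ n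
^-distrib-* x y zero    = refl
^-distrib-* x y (suc n) = trans (cong (x ℚ.* y ℚ.*_) (^-distrib-* x y n)) (interchange x y (x ^ℚ n) (y ^ℚ n))
  where
  interchange : ∀ x y z t → (x ℚ.* y) ℚ.* (z ℚ.* t) ≡ (x ℚ.* z) ℚ.* (y ℚ.* t)
  interchange x y z t = begin
    (x ℚ.* y) ℚ.* (z ℚ.* t)   ≡⟨ ℚₚ.*-assoc x y (z ℚ.* t) ⟩
    x ℚ.* (y ℚ.* (z ℚ.* t))   ≡⟨ cong (x ℚ.*_) (ℚₚ.*-assoc y z t) ⟨
    x ℚ.* (y ℚ.* z ℚ.* t)     ≡⟨ cong (λ q → x ℚ.* (q ℚ.* t)) (ℚₚ.*-comm y z) ⟩
    x ℚ.* (z ℚ.* y ℚ.* t)     ≡⟨ cong (x ℚ.*_) (ℚₚ.*-assoc z y t) ⟩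
    x ℚ.* (z ℚ.* (y ℚ.* t))   ≡⟨ ℚₚ.*-assoc x z (y ℚ.* t) ⟨
    (x ℚ.* z) ℚ.* (y ℚ.* t)   ∎
    where open ≡-Reasoning

module ClearDenominator {r : ℚ} {u w : ℕ} .{{_ : NonZero w}} (r*w≡u : r ℚ.* fromℕ w ≡ fromℕ u) where

  private
    scaled : ∀ n → r ^ℚ n ℚ.* fromℕ (w ^ n) ≡ fromℕ (u ^ n)
    scaled n = begin
      r ^ℚ n ℚ.* fromℕ (w ^ n)    ≡⟨ cong (r ^ℚ n ℚ.*_) (^-fromℕ w n) ⟨
      r ^ℚ n ℚ.* fromℕ w ^ℚ n       ≡⟨ ^-distrib-* r (fromℕ w) n ⟨
      (r ℚ.* fromℕ w) ^ℚ n          ≡⟨ cong (_^ℚ n) r*w≡u ⟩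
      fromℕ u ^ℚ n                  ≡⟨ ^-fromℕ u n ⟩
      fromℕ (u ^ n)               ∎
      where open ≡-Reasoning

    positive-power : ∀ n → ℚ.Positive (fromℕ (w ^ n))
    positive-power n = ℚ.positive (fromℕ-mono-< (ℕₚ.m^n>0 w n))

  clear : ∀ n i → r ^ℚ n ℚ.< fromℕ i → u ^ n < i * w ^ n
  clear n i lt = fromℕ-cancel-< (subst₂ ℚ._<_ (scaled n) (fromℕ-* i (w ^ n))
    (ℚₚ.*-monoˡ-<-pos (fromℕ (w ^ n)) {{positive-power n}} lt))

  unclear : ∀ n i → u ^ n < i * w ^ n → r ^ℚ n ℚ.< fromℕ i
  unclear n i lt = ℚₚ.*-cancelʳ-<-nonNeg (fromℕ (w ^ n)) {{ℚₚ.pos⇒nonNeg (fromℕ (w ^ n)) {{positive-power n}}}}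
    (subst₂ ℚ._<_ (sym (scaled n)) (sym (fromℕ-* i (w ^ n))) (fromℕ-mono-< lt))

record CommonDenominator (r r′ : ℚ) : Set where
  field
    w u u′         : ℕ
    w-nonZero      : NonZero w
    r*w≡u          : r ℚ.* fromℕ w ≡ fromℕ u
    r′*w≡u′        : r′ ℚ.* fromℕ w ≡ fromℕ u′
    gap            : 5 + u ≤ u′

commonDenominator : ∀ {r r′} → 0ℚ ℚ.≤ r → r ℚ.< r′ → CommonDenominator r r′
commonDenominator {r@(mkℚ (+ i) e₁ _)} {r′@(mkℚ (+ j) e₂ _)} 0≤r (ℚ.*<* lt) = record
  { w       = 5 * (suc e₁ * suc e₂)
  ; u       = 5 * (i * suc e₂)
  ; u′      = 5 * (j * suc e₁)
  ; w-nonZero = _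
  ; r*w≡u   = *-fromℕ r (5 * (i * suc e₂)) (5 * (suc e₁ * suc e₂))
                (cong-pos i _ (5 * (i * suc e₂)) (suc e₁) (lemma₁ i (suc e₁) (suc e₂)))
  ; r′*w≡u′ = *-fromℕ r′ (5 * (j * suc e₁)) (5 * (suc e₁ * suc e₂))
                (cong-pos j _ (5 * (j * suc e₁)) (suc e₂) (lemma₂ j (suc e₁) (suc e₂)))
  ; gap     = ℕₚ.≤-trans (ℕₚ.≤-reflexive (sym (ℕₚ.*-suc 5 (i * suc e₂)))) (ℕₚ.*-monoʳ-≤ 5
      (ℤₚ.drop‿+<+ (subst₂ ℤ._<_ (sym (ℤₚ.pos-* i (suc e₂))) (sym (ℤₚ.pos-* j (suc e₁))) lt)))
  }
  where
  cong-pos : ∀ i j k l → i * j ≡ k * l → + i ℤ.* + j ≡ + k ℤ.* + l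
  cong-pos i j k l eq = trans (sym (ℤₚ.pos-* i j)) (trans (cong +_ eq) (ℤₚ.pos-* k l))
  lemma₁ : ∀ i x y → i * (5 * (x * y)) ≡ 5 * (i * y) * x
  lemma₁ = ℕSolver.solve-∀
  lemma₂ : ∀ j x y → j * (5 * (x * y)) ≡ 5 * (j * x) * y
  lemma₂ = ℕSolver.solve-∀
commonDenominator {mkℚ (+ i) e₁ _} {mkℚ -[1+ j ] e₂ _} 0≤r (ℚ.*<* lt) =
  contradiction lt (ℤₚ.≤⇒≯ (ℤₚ.≤-trans (ℤ.-≤+ {_} {0}) (subst (+ 0 ℤ.≤_) (ℤₚ.pos-* i (suc e₂)) (ℤ.+≤+ z≤n))))
commonDenominator {mkℚ -[1+ i ] e₁ _} (ℚ.*≤* ())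

archimedean : ∀ {δ} → 0ℚ ℚ.< δ → ∀ q → ∃[ k ] q ℚ.≤ fromℕ k ℚ.* δ
archimedean {δ} 0<δ q = k , (begin
  q                             ≡⟨ ℚₚ.*-identityʳ q ⟨
  q ℚ.* 1ℚ                      ≡⟨ cong (q ℚ.*_) (ℚₚ.*-inverseˡ δ) ⟨
  q ℚ.* (ℚ.1/ δ ℚ.* δ)          ≡⟨ ℚₚ.*-assoc q (ℚ.1/ δ) δ ⟨
  q ℚ.* ℚ.1/ δ ℚ.* δ            ≤⟨ ℚₚ.*-monoʳ-≤-nonNeg δ {{ℚₚ.pos⇒nonNeg δ {{ℚ.positive 0<δ}}}} (≤-ceiling (q ℚ.* ℚ.1/ δ)) ⟩
  fromℕ k ℚ.* δ                 ∎)
  where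
  open ℚₚ.≤-Reasoning
  instance
    δ≢0 : ℚ.NonZero δ
    δ≢0 = ℚ.>-nonZero 0<δ
  -- Since denominators are at least one, the absolute numerator of `q / δ` bounds the fraction
  -- itself.
  k = ℤ.∣ ↥ (q ℚ.* ℚ.1/ δ) ∣
  ≤-ceiling : ∀ r → r ℚ.≤ fromℕ ℤ.∣ ↥ r ∣
  ≤-ceiling r rewrite fromℕ-mkℚ ℤ.∣ ↥ r ∣ = ℚ.*≤* (numerator (↥ r) (ℚ.denominator-1 r))
    where
    numerator : ∀ i e → i ℤ.* + 1 ℤ.≤ + ℤ.∣ i ∣ ℤ.* + suc e
    numerator (+ n)    e = subst₂ ℤ._≤_ (sym (ℤₚ.*-identityʳ (+ n))) (ℤₚ.pos-* n (suc e)) (ℤ.+≤+ (ℕₚ.m≤m*n n (suc e)))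
    numerator -[1+ n ] e = ℤ.-≤+

-- A march upwards from a lower bound in steps of `δ = ε / 2`. Locatedness between `l + δ` and
-- `l + 2 δ` either advances the lower bound or stops the march with an upper bound at distance `ε`;
-- disjointness rules out passing the initial upper bound.
approximate : ∀ x {ε} → 0ℚ ℚ.< ε → ∃[ q ] lower x (q ℚ.- ε) × upper x q
approximate x {ε} 0<ε =
  let l , lo = lower-inhabited x
      u , up = upper-inhabited x
      u′ , u′<u , up′ = upper-open x up
      k , le = archimedean 0<δ (u ℚ.- l)
  in search k l lo (upper-closed x (ℚₚ.<-≤-trans u′<u (reach l u k le)) up′)
  where
  δ : ℚ
  δ = ½ ℚ.* ε
  0<δ : 0ℚ ℚ.< δ
  0<δ = subst (ℚ._< δ) (ℚₚ.*-zeroʳ ½) (ℚₚ.*-monoʳ-<-pos ½ 0<ε)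
  δ+δ : δ ℚ.+ δ ≡ ε
  δ+δ = trans (sym (ℚₚ.*-distribʳ-+ ε ½ ½)) (ℚₚ.*-identityˡ ε)
  x<x+δ : ∀ q → q ℚ.< q ℚ.+ δ
  x<x+δ q = subst (ℚ._< q ℚ.+ δ) (ℚₚ.+-identityʳ q) (ℚₚ.+-monoʳ-< q 0<δ)
  reach : ∀ l u k → u ℚ.- l ℚ.≤ fromℕ k ℚ.* δ → u ℚ.≤ l ℚ.+ fromℕ k ℚ.* δ
  reach l u k le = subst (ℚ._≤ l ℚ.+ fromℕ k ℚ.* δ) cancel (ℚₚ.+-monoʳ-≤ l le)
    where
    cancel : l ℚ.+ (u ℚ.- l) ≡ u
    cancel = trans (ℚₚ.+-comm l (u ℚ.- l)) (trans (ℚₚ.+-assoc u (ℚ.- l) l)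
      (trans (cong (u ℚ.+_) (ℚₚ.+-inverseˡ l)) (ℚₚ.+-identityʳ u)))
  advance : ∀ l k → l ℚ.+ fromℕ (suc k) ℚ.* δ ≡ l ℚ.+ δ ℚ.+ fromℕ k ℚ.* δ
  advance l k = begin
    l ℚ.+ fromℕ (suc k) ℚ.* δ                  ≡⟨ cong (λ q → l ℚ.+ q ℚ.* δ) (fromℕ-suc k) ⟩
    l ℚ.+ (1ℚ ℚ.+ fromℕ k) ℚ.* δ               ≡⟨ cong (l ℚ.+_) (ℚₚ.*-distribʳ-+ δ 1ℚ (fromℕ k)) ⟩
    l ℚ.+ (1ℚ ℚ.* δ ℚ.+ fromℕ k ℚ.* δ)         ≡⟨ cong (λ q → l ℚ.+ (q ℚ.+ fromℕ k ℚ.* δ)) (ℚₚ.*-identityˡ δ) ⟩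
    l ℚ.+ (δ ℚ.+ fromℕ k ℚ.* δ)                ≡⟨ ℚₚ.+-assoc l δ (fromℕ k ℚ.* δ) ⟨
    l ℚ.+ δ ℚ.+ fromℕ k ℚ.* δ                  ∎
    where open ≡-Reasoning
  search : ∀ k l → lower x l → upper x (l ℚ.+ fromℕ k ℚ.* δ) → ∃[ q ] lower x (q ℚ.- ε) × upper x q
  search zero    l lo up = ⊥-elim (disjoint x (lo , subst (upper x)
    (trans (cong (l ℚ.+_) (ℚₚ.*-zeroˡ δ)) (ℚₚ.+-identityʳ l)) up))
  search (suc k) l lo up with located x (x<x+δ (l ℚ.+ δ))
  ... | inj₁ lo′ = search k (l ℚ.+ δ) lo′ (subst (upper x) (advance l k) up)
  ... | inj₂ up′ = l ℚ.+ ε , subst (lower x) (sym back) lo ,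
    subst (upper x) (trans (ℚₚ.+-assoc l δ δ) (cong (l ℚ.+_) δ+δ)) up′
    where
    back : l ℚ.+ ε ℚ.- ε ≡ l
    back = trans (ℚₚ.+-assoc l ε (ℚ.- ε)) (trans (cong (l ℚ.+_) (ℚₚ.+-inverseʳ ε)) (ℚₚ.+-identityʳ l))

-- Suprema and limits of roots

module _ (em : ExcludedMiddle 0ℓ) where

  -- The upper cut asks for a strictly smaller rational outside all lower cuts, which makes it open.
  -- Locatedness is where excluded middle enters.
  supremum : (x : ℕ → ℝ) → ∀ B → (∀ n → ¬ lower (x n) B) → ℝ
  supremum x B bounded = record
    { lower           = λ q → ∃[ n ] lower (x n) q
    ; upper           = λ q → ∃[ r ] r ℚ.< q × ¬ (∃[ n ] lower (x n) r)
    ; lower-inhabited = let q , l = lower-inhabited (x 0) in q , 0 , l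
    ; upper-inhabited = B ℚ.+ 1ℚ , B , B<B+1 , λ (n , l) → bounded n l
    ; lower-closed    = λ { q<r (n , l) → n , lower-closed (x n) q<r l }
    ; upper-closed    = λ { q<r (s , s<q , ¬l) → s , ℚₚ.<-trans s<q q<r , ¬l }
    ; lower-open      = λ { (n , l) → let r , q<r , l′ = lower-open (x n) l in r , q<r , n , l′ }
    ; upper-open      = λ { (s , s<q , ¬l) → let r , s<r , r<q = ℚₚ.<-dense s<q in r , r<q , s , s<r , ¬l }
    ; disjoint        = λ { ((n , l) , s , s<q , ¬l) → ¬l (n , lower-closed (x n) s<q l) }
    ; located         = located′
    }
    where
    B<B+1 : B ℚ.< B ℚ.+ 1ℚ
    B<B+1 = subst (ℚ._< B ℚ.+ 1ℚ) (ℚₚ.+-identityʳ B) (ℚₚ.+-monoʳ-< B (ℚₚ.positive⁻¹ 1ℚ))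
    located′ : ∀ {q r} → q ℚ.< r →
               (∃[ n ] lower (x n) q) ⊎ (∃[ s ] s ℚ.< r × ¬ (∃[ n ] lower (x n) s))
    located′ {q} q<r with em {∃[ n ] lower (x n) q}
    ... | yes l = inj₁ l
    ... | no ¬l = inj₂ (q , q<r , ¬l)

  module _ {x : ℕ → ℝ} {B} (bounded : ∀ n → ¬ lower (x n) B) where

    private μ = supremum x B bounded

    -- That `y n` stays below the supremum plus `ε` holds for every `n`; only the bound from the
    -- other side needs a threshold.
    below-supremum⟶ : ∀ {y : ℕ → ℝ} → (∀ n {q} → lower (y n) q → lower (x n) q) →
      (∀ q → lower μ q → ∃[ m ] ∀ n → m ≤ n → lower (y n) q) → y ⟶ μ
    below-supremum⟶ {y} y≤x eventually ε 0<ε =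
      let q , l , u = approximate μ 0<ε
          m , h = eventually (q ℚ.- ε) l
      in m , λ n m≤n → (let q′ , l′ , u′ = approximate (y n) 0<ε in q′ , u′ , n , y≤x n l′) , q , u , h n m≤n

nthRoots-bounded : ∀ {a : ℕ → ℕ} {B} → (∀ n → a n ≤ B ^ n) → ∀ n → ¬ lower (nthRoots a n) (fromℕ B)
nthRoots-bounded {a} {B} a≤ n (inj₁ B<0) = ℚₚ.<-irrefl refl (ℚₚ.≤-<-trans (fromℕ-mono-≤ {0} {B} z≤n) B<0)
nthRoots-bounded {a} {B} a≤ n (inj₂ lt)  =
  ℕₚ.<⇒≱ (fromℕ-cancel-< (subst (ℚ._< fromℕ (a (suc n))) (^-fromℕ B (suc n)) lt)) (a≤ (suc n))

nthRoots-mono : ∀ {a a′ : ℕ → ℕ} → (∀ n → a n ≤ a′ n) →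
                ∀ n {q} → lower (nthRoots a n) q → lower (nthRoots a′ n) q
nthRoots-mono a≤ n (inj₁ q<0) = inj₁ q<0
nthRoots-mono a≤ n (inj₂ lt)  = inj₂ (ℚₚ.<-≤-trans lt (fromℕ-mono-≤ (a≤ (suc n))))

-- A rational below the n-th root of a n is u / w with u ^ n < a n * w ^ n; the
-- gap 5 leaves room for the strict losses between consecutive growth rates.
Follows : (ℕ → ℕ) → (ℕ → ℕ) → Set
Follows a a′ = ∀ w .{{_ : NonZero w}} {u v} M .{{_ : NonZero M}} → 5 + u ≤ v →
               v ^ M ≤ a′ M * w ^ M → Outgrows (Weighted.weighted w a) u

module _ {a a′ : ℕ → ℕ} (follows : Follows a a′) where

  -- Openness of the lower cut provides some `r` above `q` below the same root. Over a common
  -- denominator the two become integers far enough apart for `follows`.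
  below-root-eventually : ∀ {q} → ∃[ n ] lower (nthRoots a′ n) q →
                          ∃[ m ] ∀ n → m ≤ n → lower (nthRoots a n) q
  below-root-eventually {q} (k , l) with q ℚ.<? 0ℚ
  ... | yes q<0 = 0 , λ _ _ → inj₁ q<0
  ... | no  q≮0 = beyond (lower-open (nthRoots a′ k) l)
    where
    0≤q : 0ℚ ℚ.≤ q
    0≤q = ℚₚ.≮⇒≥ q≮0
    beyond : ∃[ r ] q ℚ.< r × lower (nthRoots a′ k) r → ∃[ m ] ∀ n → m ≤ n → lower (nthRoots a n) q
    beyond (r , q<r , inj₁ r<0) = ⊥-elim (q≮0 (ℚₚ.<-trans q<r r<0))
    beyond (r , q<r , inj₂ lt)  = m , λ n m≤n →
      inj₂ (ClearDenominator.unclear {q} {u} {w} r*w≡u (suc n) (a (suc n)) (h (suc n) (ℕₚ.m≤n⇒m≤1+n m≤n)))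
      where
      open CommonDenominator (commonDenominator 0≤q q<r)
      instance
        w≢0 : NonZero w
        w≢0 = w-nonZero
      outgrown : Outgrows (Weighted.weighted w a) u
      outgrown = follows w (suc k) gap (ℕₚ.<⇒≤ (ClearDenominator.clear {r} {u′} {w} r′*w≡u′ (suc k) (a′ (suc k)) lt))
      m = proj₁ outgrown
      h = proj₂ outgrown

module _ {p d b : ℕ → ℕ} {c : ℕ → ℕ → ℕ}
  (p-* : SuperMultiplicative p) (d-* : SuperMultiplicative d) (b-* : SuperMultiplicative b)
  (c-* : ∀ k → SuperMultiplicative (c k))
  (p₀ : 1 ≤ p 0) (p₁ : 1 ≤ p 1) (d₀ : 1 ≤ d 0) (d₁ : 1 ≤ d 1)
  (p≤b : ∀ n → p n ≤ b n) (d≤b : ∀ n → d n ≤ b n) (b≤d : ∀ n → b n ≤ d (2 + n))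
  (p≤c : ∀ k n → p n ≤ c k n) (c≤p : ∀ k n → c k n ≤ p (k * 3 + n))
  (b²≤c : ∀ n → b n * b n ≤ suc (4 * n) * suc (4 * n) * c (4 * n) (2 * n))
  {B} (b≤ : ∀ n → b n ≤ B ^ n) (em : ExcludedMiddle 0ℓ) where

  private
    module C = Comparison {p} {d} {b} {c} p-* d-* b-* c-* p₀ p₁ d₀ d₁ p≤b b≤d p≤c c≤p b²≤c

    b-follows : Follows b b
    b-follows w M le = C.b-outgrows w M (ℕₚ.≤-trans (ℕₚ.m≤n+m _ 4) le)

    b-outgrows-4+ : ∀ w .{{_ : NonZero w}} {u v} M .{{_ : NonZero M}} → 5 + u ≤ v →
               v ^ M ≤ b M * w ^ M → Outgrows (Weighted.weighted w b) (4 + u)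
    b-outgrows-4+ w M le = C.b-outgrows w M le

    d-follows : Follows d b
    d-follows w {u} M le h = C.d-outgrows w (ℕₚ.m≤n+m (2 + u) 2) (b-outgrows-4+ w M le h)

    -- The gap 5 is used up here: one unit for Fekete's lemma on `b`, one for the polynomial factor,
    -- and three for the descent from `c k` to `p`.
    p-follows : Follows p b
    p-follows w {u} M le h = C.p-outgrows w (ℕₚ.n<1+n (3 + u)) (b-outgrows-4+ w M le h)

  -- The limit in Fekete's lemma is the supremum of the roots, so the roots of `b`, the largest of
  -- the three sequences, name it for all.
  common-limit : ∃[ μ ] (nthRoots p ⟶ μ) × (nthRoots d ⟶ μ) × (nthRoots b ⟶ μ)
  common-limit = supremum em (nthRoots b) (fromℕ B) bounded ,
    limit p≤b p-follows , limit d≤b d-follows , limit (λ _ → ℕₚ.≤-refl) b-follows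
    where
    bounded = nthRoots-bounded {b} b≤
    limit : ∀ {a} → (∀ n → a n ≤ b n) → Follows a b → nthRoots a ⟶ supremum em (nthRoots b) (fromℕ B) bounded
    limit {a} a≤b follows = below-supremum⟶ em {nthRoots b} {fromℕ B} bounded {nthRoots a}
      (λ n {q} → nthRoots-mono {a} {b} a≤b n {q}) (λ q → below-root-eventually {a} {b} follows {q})

≈ᴿ-refl : ∀ {x} → x ≈ᴿ x
≈ᴿ-refl q = mk⇔ id id , mk⇔ id id

theorem2p1 : ExcludedMiddle 0ℓ →
    ∃[ μp ] ∃[ μd ] ∃[ μb ]
    (nthRoots p ⟶ μp) × (nthRoots d ⟶ μd) × (nthRoots b ⟶ μb) ×
    (μp ≈ᴿ μd) × (μd ≈ᴿ μb)
theorem2p1 em =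
  let open CentralWalks em
      μ , p⟶μ , d⟶μ , b⟶μ = common-limit {p} {d} {b} {c} p-* d-* b-* c-*
        (proj₁ p-pos) (proj₂ p-pos) (proj₁ d-pos) (proj₂ d-pos) p≤b d≤b b≤d p≤c c≤p b²≤c b≤16^ em
  in μ , μ , μ , p⟶μ , d⟶μ , b⟶μ , ≈ᴿ-refl {μ} , ≈ᴿ-refl {μ}
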